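{- Let $G$ be a finite group with commutator subgroup $G'=[G,G]$. (1) If there is a prime factor $\pi_1$ of $|G|$ whose multiplicity in the prime factorization of $|G|$ is odd, and $[G:G']$ has a prime factor $\pi_2\neq\pi_1$, then $G$ does not admit a skew-Hadamard difference set. (2) In particular, if $G$ admits a skew-Hadamard difference set, then there is a prime $p\equiv 3\pmod 4$ such that $G/G'$ is a $p$-group and the multiplicity of $p$ in the prime factorization of $|G|$ is odd.
   Context: Let $G$ be a finite group of order $v$. A $(v,k,\lambda)$ difference set in $G$ is a subset $D\subseteq G$ of size $k$ such that each non-identity element of $G$ can be written as $d_1d_2^{ -1}$ with $d_1\neq d_2$ in $D$ in exactly $\lambda$ distinct ways. A skew-Hadamard difference set (SHDS) in $G$ is a difference set $D$ such that $G$ is the disjoint union of $D$, $D^{(-1)}$ and $\{1\}$, where $D^{(-1)}=\{d^{ -1}: d\in D\}$, and whose parameters are $v=4n-1$, $k=2n-1$, $\lambda=n-1$ for some positive integer $n$ (for nontrivial $G$ this condition on the parameters is automatic; it excludes the trivial group with $D=\emptyset$). We say that $G$ admits an SHDS if such a $D\subseteq G$ exists. -}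

module Defs where

open import Level using (Level; _⊔_; suc)
open import Algebra.Bundles using (Group)
import Algebra.Properties.Group as GroupProperties
open import Data.Fin.Base using (Fin)
open import Data.Fin.Properties using (nonZeroIndex)
open import Data.List.Base using (length; filter)
open import Data.Nat.Base using (ℕ; NonZero; _*_; _∸_; _^_)
open import Data.Nat.Properties using (_≟_)
open import Data.Nat.Primality.Factorisation using (factors; factorise)
open import Data.Product.Base using (Σ-syntax; ∃-syntax; _×_; _,_; proj₁)
open import Data.Product.Relation.Binary.Pointwise.NonDependent using (×-setoid)
open import Data.Sum.Base using (_⊎_)
open import Function.Bundles using (Inverse)
open import Relation.Binary.Bundles using (Setoid)
import Relation.Binary.Construct.On as On
import Relation.Binary.PropositionalEquality as ≡
import Relation.Binary.Reasoning.Setoid as SetoidReasoning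
open import Relation.Nullary using (¬_)
open import Relation.Unary using (Pred; _∈_; _∉_)

private
  variable
    a c ℓ p : Level

infix 4 _HasSize_

_HasSize_ : Setoid a ℓ → ℕ → Set (a ⊔ ℓ)
S HasSize n = Inverse S (≡.setoid (Fin n))

multiplicity : ℕ → (n : ℕ) .{{_ : NonZero n}} → ℕ
multiplicity q n = length (filter (q ≟_) (factors (factorise n)))

record FiniteGroup (c ℓ : Level) : Set (suc (c ⊔ ℓ)) where
  field
    group   : Group c ℓ
    order   : ℕ
    hasSize : Group.setoid group HasSize order

  open Group group public

  order-nonZero : NonZero order
  order-nonZero = nonZeroIndex (Inverse.to hasSize ε)

∣_∣ : FiniteGroup c ℓ → ℕ
∣ G ∣ = FiniteGroup.order G

module _ (G : Group c ℓ) where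
  open Group G
  open GroupProperties G
  open SetoidReasoning setoid

  record IsSubgroup (H : Pred Carrier p) : Set (c ⊔ ℓ ⊔ p) where
    field
      resp      : ∀ {x y} → x ≈ y → x ∈ H → y ∈ H
      ε-closed  : ε ∈ H
      ∙-closed  : ∀ {x y} → x ∈ H → y ∈ H → x ∙ y ∈ H
      ⁻¹-closed : ∀ {x} → x ∈ H → x ⁻¹ ∈ H

  record IsNormalSubgroup (H : Pred Carrier p) : Set (c ⊔ ℓ ⊔ p) where
    field
      isSubgroup : IsSubgroup H
      normal     : ∀ g {h} → h ∈ H → g ⁻¹ ∙ h ∙ g ∈ H

    open IsSubgroup isSubgroup public

  -- The set of left cosets: x and y are identified when xH = yH.
  leftCosets : {H : Pred Carrier p} → IsSubgroup H → Setoid c p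
  leftCosets {H = H} isSubgroup = record
    { Carrier       = Carrier
    ; _≈_           = λ x y → x ⁻¹ ∙ y ∈ H
    ; isEquivalence = record
      { refl  = λ {x} → resp (sym (inverseˡ x)) ε-closed
      ; sym   = λ {x} {y} xy → resp (⁻¹-anti-homo-\\ x y) (⁻¹-closed xy)
      ; trans = λ {x} {y} {z} xy yz → resp (trans-lemma x y z) (∙-closed xy yz)
      }
    }
    where
    open IsSubgroup isSubgroup
    trans-lemma : ∀ x y z → (x ⁻¹ ∙ y) ∙ (y ⁻¹ ∙ z) ≈ x ⁻¹ ∙ z
    trans-lemma x y z = begin
      (x ⁻¹ ∙ y) ∙ (y ⁻¹ ∙ z) ≈⟨ assoc _ _ _ ⟩
      x ⁻¹ ∙ (y ∙ (y ⁻¹ ∙ z)) ≈⟨ ∙-congˡ (\\-leftDividesˡ y z) ⟩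
      x ⁻¹ ∙ z                ∎

  -- [G : H] = m
  Index : {H : Pred Carrier p} → IsSubgroup H → ℕ → Set (c ⊔ p)
  Index isSubgroup m = leftCosets isSubgroup HasSize m

  quotient : {H : Pred Carrier p} → IsNormalSubgroup H → Group c p
  quotient {H = H} isNormal = record
    { Carrier = Carrier
    ; _≈_     = Setoid._≈_ cosets
    ; _∙_     = _∙_
    ; ε       = ε
    ; _⁻¹     = _⁻¹
    ; isGroup = record
      { isMonoid = record
        { isSemigroup = record
          { isMagma = record
            { isEquivalence = Setoid.isEquivalence cosets
            ; ∙-cong        = λ {x} {y} {u} {w} xy uw →
                resp (∙-lemma x y u w) (∙-closed (normal u xy) uw)
            }
          ; assoc = λ x y z → ≈⇒ (assoc x y z)
          }
        ; identity = (λ x → ≈⇒ (identityˡ x)) , (λ x → ≈⇒ (identityʳ x))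
        }
      ; inverse = (λ x → ≈⇒ (inverseˡ x)) , (λ x → ≈⇒ (inverseʳ x))
      ; ⁻¹-cong = λ {x} {y} xy →
          resp (⁻¹-lemma x y) (normal (x ⁻¹) (⁻¹-closed xy))
      }
    }
    where
    open IsNormalSubgroup isNormal
    cosets = leftCosets isSubgroup

    ≈⇒ : ∀ {x y} → x ≈ y → x ⁻¹ ∙ y ∈ H
    ≈⇒ {x} x≈y = resp (trans (sym (inverseˡ x)) (∙-congˡ x≈y)) ε-closed

    ∙-lemma : ∀ x y u w →
      (u ⁻¹ ∙ (x ⁻¹ ∙ y) ∙ u) ∙ (u ⁻¹ ∙ w) ≈ (x ∙ u) ⁻¹ ∙ (y ∙ w)
    ∙-lemma x y u w = begin
      (u ⁻¹ ∙ (x ⁻¹ ∙ y) ∙ u) ∙ (u ⁻¹ ∙ w) ≈⟨ assoc _ _ _ ⟩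
      u ⁻¹ ∙ (x ⁻¹ ∙ y) ∙ (u ∙ (u ⁻¹ ∙ w)) ≈⟨ ∙-congˡ (\\-leftDividesˡ u w) ⟩
      u ⁻¹ ∙ (x ⁻¹ ∙ y) ∙ w                ≈⟨ ∙-congʳ (assoc _ _ _) ⟨
      u ⁻¹ ∙ x ⁻¹ ∙ y ∙ w                  ≈⟨ assoc _ _ _ ⟩
      u ⁻¹ ∙ x ⁻¹ ∙ (y ∙ w)                ≈⟨ ∙-congʳ (⁻¹-anti-homo-∙ x u) ⟨
      (x ∙ u) ⁻¹ ∙ (y ∙ w)                 ∎

    ⁻¹-lemma : ∀ x y →
      (x ⁻¹) ⁻¹ ∙ (x ⁻¹ ∙ y) ⁻¹ ∙ x ⁻¹ ≈ (x ⁻¹) ⁻¹ ∙ y ⁻¹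
    ⁻¹-lemma x y = begin
      (x ⁻¹) ⁻¹ ∙ (x ⁻¹ ∙ y) ⁻¹ ∙ x ⁻¹   ≈⟨ ∙-congʳ (∙-congˡ (⁻¹-anti-homo-\\ x y)) ⟩
      (x ⁻¹) ⁻¹ ∙ (y ⁻¹ ∙ x) ∙ x ⁻¹      ≈⟨ assoc _ _ _ ⟩
      (x ⁻¹) ⁻¹ ∙ (y ⁻¹ ∙ x ∙ x ⁻¹)      ≈⟨ ∙-congˡ (//-rightDividesʳ x (y ⁻¹)) ⟩
      (x ⁻¹) ⁻¹ ∙ y ⁻¹                   ∎

  data ⟨_⟩ (S : Pred Carrier p) : Pred Carrier (c ⊔ ℓ ⊔ p) where
    gen  : ∀ {x} → x ∈ S → x ∈ ⟨ S ⟩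
    eq   : ∀ {x y} → x ≈ y → x ∈ ⟨ S ⟩ → y ∈ ⟨ S ⟩
    unit : ε ∈ ⟨ S ⟩
    mult : ∀ {x y} → x ∈ ⟨ S ⟩ → y ∈ ⟨ S ⟩ → x ∙ y ∈ ⟨ S ⟩
    inv  : ∀ {x} → x ∈ ⟨ S ⟩ → x ⁻¹ ∈ ⟨ S ⟩

  IsCommutator : Pred Carrier (c ⊔ ℓ)
  IsCommutator g = ∃[ x ] ∃[ y ] g ≈ (x ⁻¹ ∙ y ⁻¹) ∙ (x ∙ y)

  CommutatorSubgroup : Pred Carrier (c ⊔ ℓ)
  CommutatorSubgroup = ⟨ IsCommutator ⟩

  commutator-isNormalSubgroup : IsNormalSubgroup CommutatorSubgroup
  commutator-isNormalSubgroup = record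
    { isSubgroup = record
      { resp      = eq
      ; ε-closed  = unit
      ; ∙-closed  = mult
      ; ⁻¹-closed = inv
      }
    ; normal = λ g {h} h∈ → eq (lemma g h) (mult h∈ (gen (h , g , refl)))
    }
    where
    lemma : ∀ g h → h ∙ ((h ⁻¹ ∙ g ⁻¹) ∙ (h ∙ g)) ≈ g ⁻¹ ∙ h ∙ g
    lemma g h = begin
      h ∙ ((h ⁻¹ ∙ g ⁻¹) ∙ (h ∙ g)) ≈⟨ ∙-congˡ (assoc _ _ _) ⟩
      h ∙ (h ⁻¹ ∙ (g ⁻¹ ∙ (h ∙ g))) ≈⟨ \\-leftDividesˡ h _ ⟩
      g ⁻¹ ∙ (h ∙ g)                ≈⟨ assoc _ _ _ ⟨
      g ⁻¹ ∙ h ∙ g                  ∎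

  commutator-isSubgroup : IsSubgroup CommutatorSubgroup
  commutator-isSubgroup = IsNormalSubgroup.isSubgroup commutator-isNormalSubgroup

  -- G / G′
  abelianisation : Group c (c ⊔ ℓ)
  abelianisation = quotient commutator-isNormalSubgroup

-- Finite p-groups; the trivial group is one for every q.
IsPGroup : ℕ → Group c ℓ → Set (c ⊔ ℓ)
IsPGroup q G = ∃[ k ] Group.setoid G HasSize (q ^ k)

module _ (G : FiniteGroup c ℓ) where
  open FiniteGroup G

  -- A subset having a size is automatically decidable, and equivalent to a
  -- predicate at level ℓ, so neither decidability nor other levels are needed.
  record Subset : Set (c ⊔ suc ℓ) where
    field
      pred : Pred Carrier ℓ
      resp : ∀ {x y} → x ≈ y → x ∈ pred → y ∈ pred

  elements : Pred Carrier p → Setoid (c ⊔ p) ℓ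
  elements P = On.setoid {B = Σ[ x ∈ Carrier ] x ∈ P} setoid proj₁

  -- The ways of writing g as d₁ d₂⁻¹ with d₁ ≠ d₂ in D.
  representations : Pred Carrier p → Carrier → Setoid (c ⊔ ℓ ⊔ p) ℓ
  representations D g = On.setoid
    {B = Σ[ (d₁ , d₂) ∈ Carrier × Carrier ]
           d₁ ∈ D × d₂ ∈ D × ¬ (d₁ ≈ d₂) × g ≈ d₁ ∙ d₂ ⁻¹}
    (×-setoid setoid setoid) proj₁

  record IsDifferenceSet (v k μ : ℕ) (D : Subset) : Set (c ⊔ ℓ) where
    open Subset D
    field
      order≡v    : order ≡.≡ v
      size       : elements pred HasSize k
      difference : ∀ g → ¬ (g ≈ ε) → representations pred g HasSize μ

  -- D⁽⁻¹⁾
  Inverses : Pred Carrier p → Pred Carrier (c ⊔ ℓ ⊔ p)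
  Inverses D g = ∃[ d ] d ∈ D × g ≈ d ⁻¹

  record IsSHDS (D : Subset) : Set (c ⊔ ℓ) where
    open Subset D
    field
      n               : ℕ
      .{{n-nonZero}}  : NonZero n  -- so none of the ∸ below truncates
      isDifferenceSet : IsDifferenceSet (4 * n ∸ 1) (2 * n ∸ 1) (n ∸ 1) D
      covers          : ∀ g → g ∈ pred ⊎ g ∈ Inverses pred ⊎ g ≈ ε
      D∩D⁻¹≡∅         : ∀ g → g ∈ pred → g ∉ Inverses pred
      ε∉D             : ε ∉ pred
      ε∉D⁻¹           : ε ∉ Inverses pred

  AdmitsSHDS : Set (c ⊔ suc ℓ)
  AdmitsSHDS = Σ[ D ∈ Subset ] IsSHDS D

{-# OPTIONS --safe #-}
module Submission where

-- Let B be a finite abelian quotient of G without p-torsion. Modulo p, the p-th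
-- power of an element of ℤ[B] is obtained by applying b ↦ bᵖ, which is
-- injective, so ℤ[B] / p has no nilpotents. Hence if p^(2k+1) divides a square
-- in ℤ[B], so does p^(2k+2). A skew-Hadamard difference set D satisfies
-- (1 + 2D)² = (v + 1) G − v in ℤ[G], and the image of the right-hand side in
-- ℤ[B] has the coefficient (v + 1) v / |B| at every b ≠ 1. When p divides v to an
-- odd power this is a contradiction, as p ∤ |B|; so B is trivial. Taking for B
-- the quotient of G / G′ by its p-primary part shows that G / G′ is a p-group.
-- Everything is moved to one side so that only natural numbers occur, and
-- elements of the group ring are represented by lists of group elements.

open import Defs
open import Data.Nat.Base using (ℕ; _%_)
open import Data.Nat.Divisibility using (_∣_)
open import Data.Nat.Primality using (Prime)
open import Data.Product.Base using (∃-syntax; _×_)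
open import Relation.Binary.PropositionalEquality using (_≡_; _≢_)
open import Relation.Nullary using (¬_)

open import Level using (Level; _⊔_)
open import Algebra.Bundles using (AbelianGroup; CommutativeMonoid; Group; Semiring)
open import Algebra.Morphism.Structures using (IsGroupHomomorphism)
import Algebra.Properties.CommutativeMonoid.Mult as CommutativeMult
import Algebra.Properties.CommutativeMonoid.Sum as CommutativeSum
import Algebra.Properties.CommutativeSemigroup as CommutativeSemigroupProperties
import Algebra.Properties.Group as GroupProperties
import Algebra.Properties.Monoid.Mult as Mult
import Algebra.Properties.Semiring.Binomial as Binomial
import Algebra.Properties.Semiring.Exp as Exp
import Algebra.Properties.Semiring.Sum as Sum
open import Data.Fin.Base as Fin using (Fin; zero; suc; toℕ)
open import Data.Fin.Permutation using (Permutation; permutation)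
import Data.Fin.Properties as Fin
import Data.Fin.Subset as FinSubset
open import Data.Fin.Subset.Induction using (⊃-wellFounded)
import Data.Fin.Subset.Properties as FinSubset
open import Data.List.Base
  using (List; []; _∷_; _++_; allFin; concatMap; filter; length; map; replicate; tabulate)
open import Data.List.Properties using (filter-accept; filter-reject; length-filter)
open import Data.List.Relation.Unary.All as All using (All; []; _∷_)
open import Data.List.Relation.Unary.All.Properties using (all-filter; filter⁺)
open import Data.Nat.Base as ℕ using (zero; suc; NonZero; z<s; s<s)
open import Data.Nat.Combinatorics using (_C_; k![n∸k]!∣n!; nCn≡1)
open import Data.Nat.Combinatorics.Specification using (nCk≡n!/k![n-k]!)
open import Data.Nat.Coprimality using (Coprime; coprime-Bézout; coprime-divisor)
open import Data.Nat.Divisibility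
open import Data.Nat.DivMod
  using ([m+kn]%n≡m%n; _/_; %-distribˡ-*; %-distribˡ-+; m%n<n; m*[n/m]≡n; m/n*n≡m; m≡m%n+[m/n]*n)
open import Data.Nat.GCD using (module Bézout)
open import Data.Nat.ListAction using (product)
open import Data.Nat.Primality
  using (euclidsLemma; prime⇒irreducible; prime⇒nonTrivial; prime⇒nonZero; ¬prime[1])
open import Data.Nat.Primality.Factorisation
  using (factorise; factorisationHasAllPrimeFactors; module PrimeFactorisation)
import Data.Nat.Properties as ℕ
open import Data.Nat.Tactic.RingSolver using (solve-∀)
open import Data.Product.Base using (Σ-syntax; _,_; proj₁; proj₂)
open import Data.Sum.Base using (_⊎_; inj₁; inj₂)
open import Function.Base using (_∘_; case_of_)
open import Function.Bundles using (Inverse)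
open import Induction.WellFounded using (Acc; acc)
open import Relation.Binary.Bundles using (Setoid)
import Relation.Binary.Construct.On as On
open import Relation.Binary.Core using (Rel)
open import Relation.Binary.Definitions using (Decidable; _Respects_)
open import Relation.Binary.PropositionalEquality as ≡ using (_≗_; cong; cong₂; module ≡-Reasoning)
import Relation.Binary.Reasoning.Setoid as SetoidReasoning
open import Relation.Binary.Structures using (IsEquivalence)
open import Relation.Nullary using (Dec; contradiction; no; yes)
open import Relation.Nullary.Decidable as Dec using (_×-dec_; _⊎-dec_; ¬?; decidable-stable)
open import Relation.Unary using (Pred; _∈_; _∉_) renaming (Decidable to Decidable₁)

-- Origin of the square: since `G = 1 + D + D⁻¹`, the element `1 + 2D` equals `G + (D − D⁻¹)`, and
-- `D − D⁻¹` is a square root of `G − v` in the group ring. The form `1 + 2D` has no negative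
-- coefficients. The identity holds in ℤ[G] for non-abelian `G`. Commutativity is needed only for
-- the binomial theorem behind the p-th power map, and this is what forces the passage to an abelian
-- quotient. The absence of p-torsion in `B` is used twice: for the injectivity of b ↦ bᵖ, and for p
-- ∤ |B|. The latter is itself a consequence of the missing nilpotents, applied to the sum of all
-- elements of `B`. The second statement needs a prime to start from: `v = 4n − 1` is 3 modulo 4,
-- which is impossible if every prime that is 3 modulo 4 occurs in `v` to an even power.

private
  variable
    a b c ℓ ℓ′ p q r : Level

-- Finite sums

module _ where
  open import Data.Nat.Base using (_+_; _*_)
  open import Data.Nat.Properties hiding (_≟_)
  open import Relation.Binary.PropositionalEquality using (refl; sym; trans)

  private
    variable
      A : Set a
      B : Set b
      P : Set p
      Q : Set q
      R : Set r

  ∑ : List A → (A → ℕ) → ℕ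
  ∑ []       f = 0
  ∑ (x ∷ xs) f = f x + ∑ xs f

  ∑-cong : ∀ (xs : List A) {f g} → f ≗ g → ∑ xs f ≡ ∑ xs g
  ∑-cong []       f≗g = refl
  ∑-cong (x ∷ xs) f≗g = cong₂ _+_ (f≗g x) (∑-cong xs f≗g)

  ∑-zero : ∀ (xs : List A) → ∑ xs (λ _ → 0) ≡ 0
  ∑-zero []       = refl
  ∑-zero (x ∷ xs) = ∑-zero xs

  ∑-+ : ∀ (xs : List A) f g → ∑ xs (λ x → f x + g x) ≡ ∑ xs f + ∑ xs g
  ∑-+ []       f g = refl
  ∑-+ (x ∷ xs) f g rewrite ∑-+ xs f g = lemma (f x) (g x) (∑ xs f) (∑ xs g)
    where
    lemma : ∀ m n o p → m + n + (o + p) ≡ m + o + (n + p)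
    lemma = solve-∀

  ∑-*ˡ : ∀ (xs : List A) k f → ∑ xs (λ x → k * f x) ≡ k * ∑ xs f
  ∑-*ˡ []       k f = sym (*-zeroʳ k)
  ∑-*ˡ (x ∷ xs) k f rewrite ∑-*ˡ xs k f = sym (*-distribˡ-+ k (f x) (∑ xs f))

  ∑-*ʳ : ∀ (xs : List A) f k → ∑ xs (λ x → f x * k) ≡ ∑ xs f * k
  ∑-*ʳ []       f k = refl
  ∑-*ʳ (x ∷ xs) f k rewrite ∑-*ʳ xs f k = sym (*-distribʳ-+ k (f x) (∑ xs f))

  ∑-swap : ∀ (xs : List A) (ys : List B) (f : A → B → ℕ) →
           ∑ xs (λ x → ∑ ys (f x)) ≡ ∑ ys (λ y → ∑ xs (λ x → f x y))
  ∑-swap []       ys f = sym (∑-zero ys)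
  ∑-swap (x ∷ xs) ys f = trans (cong (∑ ys (f x) +_) (∑-swap xs ys f))
                               (sym (∑-+ ys (f x) _))

  ∑-++ : ∀ (xs ys : List A) f → ∑ (xs ++ ys) f ≡ ∑ xs f + ∑ ys f
  ∑-++ []       ys f = refl
  ∑-++ (x ∷ xs) ys f rewrite ∑-++ xs ys f = sym (+-assoc (f x) _ _)

  ∑-map : ∀ (h : A → B) xs f → ∑ (map h xs) f ≡ ∑ xs (f ∘ h)
  ∑-map h []       f = refl
  ∑-map h (x ∷ xs) f = cong (f (h x) +_) (∑-map h xs f)

  ∑-replicate : ∀ n (x : A) f → ∑ (replicate n x) f ≡ n * f x
  ∑-replicate zero    x f = refl
  ∑-replicate (suc n) x f = cong (f x +_) (∑-replicate n x f)

  ∑-concatMap : ∀ (h : A → List B) xs f → ∑ (concatMap h xs) f ≡ ∑ xs (λ x → ∑ (h x) f)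
  ∑-concatMap h []       f = refl
  ∑-concatMap h (x ∷ xs) f =
    trans (∑-++ (h x) _ f) (cong (∑ (h x) f +_) (∑-concatMap h xs f))

  ∑-tabulate : ∀ {n} (h : Fin n → A) f → ∑ (tabulate h) f ≡ ∑ (allFin n) (f ∘ h)
  ∑-tabulate {n = zero}  h f = refl
  ∑-tabulate {n = suc n} h f = cong (f (h zero) +_)
    (trans (∑-tabulate (h ∘ suc) f) (sym (∑-tabulate {n = n} Fin.suc (f ∘ h))))

  ∑-allFin-1 : ∀ n → ∑ (allFin n) (λ _ → 1) ≡ n
  ∑-allFin-1 zero    = refl
  ∑-allFin-1 (suc n) = cong suc (trans (∑-tabulate {n = n} Fin.suc (λ _ → 1)) (∑-allFin-1 n))

  ∑-∣ : ∀ {d} (xs : List A) {f} → (∀ x → d ∣ f x) → d ∣ ∑ xs f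
  ∑-∣ {d = d} []       d∣f = d ∣0
  ∑-∣         (x ∷ xs) d∣f = ∣m∣n⇒∣m+n (d∣f x) (∑-∣ xs d∣f)

  -- The Iverson bracket. Cardinalities are sums of it, which turns every double counting into an
  -- application of `∑-swap`.
  ⟦_⟧ : Dec P → ℕ
  ⟦ yes _ ⟧ = 1
  ⟦ no  _ ⟧ = 0

  ⟦⟧-yes : (P? : Dec P) → P → ⟦ P? ⟧ ≡ 1
  ⟦⟧-yes (yes _) _  = refl
  ⟦⟧-yes (no ¬p) pf = contradiction pf ¬p

  ⟦⟧-no : (P? : Dec P) → ¬ P → ⟦ P? ⟧ ≡ 0
  ⟦⟧-no (yes pf) ¬p = contradiction pf ¬p
  ⟦⟧-no (no _)   _  = refl

  ⟦⟧-cong : (P? : Dec P) (Q? : Dec Q) → (P → Q) → (Q → P) → ⟦ P? ⟧ ≡ ⟦ Q? ⟧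
  ⟦⟧-cong (yes pf) Q? to from = sym (⟦⟧-yes Q? (to pf))
  ⟦⟧-cong (no ¬p)  Q? to from = sym (⟦⟧-no Q? (¬p ∘ from))

  ⟦⟧-× : (R? : Dec R) (P? : Dec P) (Q? : Dec Q) →
         (P → Q → R) → (R → P × Q) → ⟦ R? ⟧ ≡ ⟦ P? ⟧ * ⟦ Q? ⟧
  ⟦⟧-× R? (yes p) (yes q) to from = ⟦⟧-yes R? (to p q)
  ⟦⟧-× R? (yes p) (no ¬q) to from = ⟦⟧-no R? (¬q ∘ proj₂ ∘ from)
  ⟦⟧-× R? (no ¬p) Q?      to from = ⟦⟧-no R? (¬p ∘ proj₁ ∘ from)

  ∑-allFin-≟ : ∀ {n} (j : Fin n) → ∑ (allFin n) (λ i → ⟦ i Fin.≟ j ⟧) ≡ 1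
  ∑-allFin-≟ {suc n} zero = cong suc (trans (∑-tabulate {n = n} Fin.suc _)
    (trans (∑-cong (allFin n) (λ i → ⟦⟧-no (suc i Fin.≟ zero) λ ())) (∑-zero (allFin n))))
  ∑-allFin-≟ {suc n} (suc j) = trans (∑-tabulate {n = n} Fin.suc _)
    (trans (∑-cong (allFin n) (λ i →
              ⟦⟧-cong (suc i Fin.≟ suc j) (i Fin.≟ j) Fin.suc-injective (cong suc)))
           (∑-allFin-≟ j))

  module Enumeration {S : Setoid c ℓ} {n} (hasSize : S HasSize n) where
    open Setoid S hiding (refl) renaming (sym to ≈-sym; trans to ≈-trans)
    open Inverse hasSize using (to; from; to-cong; from-cong; strictlyInverseˡ; strictlyInverseʳ)

    infix 4 _≟_

    to-injective : ∀ {x y} → to x ≡ to y → x ≈ y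
    to-injective {x} {y} e≡ =
      ≈-trans (≈-sym (strictlyInverseʳ x)) (≈-trans (from-cong e≡) (strictlyInverseʳ y))

    _≟_ : Decidable _≈_
    x ≟ y = Dec.map′ to-injective to-cong (to x Fin.≟ to y)
  
    elems : List Carrier
    elems = map from (allFin n)

    ∑-elems : ∀ f → ∑ elems f ≡ ∑ (allFin n) (f ∘ from)
    ∑-elems = ∑-map from (allFin n)

    ∑-1 : ∑ elems (λ _ → 1) ≡ n
    ∑-1 = trans (∑-elems _) (∑-allFin-1 n)

    ∑-const : ∀ k → ∑ elems (λ _ → k) ≡ n * k
    ∑-const k = trans (∑-cong elems (λ _ → sym (*-identityˡ k)))
      (trans (∑-*ʳ elems (λ _ → 1) k) (cong (_* k) ∑-1))

    ∑-≟ : ∀ x → ∑ elems (λ y → ⟦ y ≟ x ⟧) ≡ 1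
    ∑-≟ x = trans (∑-elems _) (trans (∑-cong (allFin n) (λ i →
      ⟦⟧-cong (from i ≟ x) (i Fin.≟ to x)
        (λ e≡ → trans (sym (strictlyInverseˡ i)) (to-cong e≡))
        (λ e≡ → ≈-trans (from-cong e≡) (strictlyInverseʳ x))))
      (∑-allFin-≟ (to x)))

    ∑-δ : ∀ (φ : Carrier → ℕ) → (∀ {x y} → x ≈ y → φ x ≡ φ y) →
          ∀ x → ∑ elems (λ y → ⟦ y ≟ x ⟧ * φ y) ≡ φ x
    ∑-δ φ φ-cong x = begin
      ∑ elems (λ y → ⟦ y ≟ x ⟧ * φ y) ≡⟨ ∑-cong elems lemma ⟩
      ∑ elems (λ y → ⟦ y ≟ x ⟧ * φ x) ≡⟨ ∑-*ʳ elems _ (φ x) ⟩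
      ∑ elems (λ y → ⟦ y ≟ x ⟧) * φ x ≡⟨ cong (_* φ x) (∑-≟ x) ⟩
      1 * φ x                         ≡⟨ *-identityˡ (φ x) ⟩
      φ x                             ∎
      where
      open ≡-Reasoning
      lemma : ∀ y → ⟦ y ≟ x ⟧ * φ y ≡ ⟦ y ≟ x ⟧ * φ x
      lemma y with y ≟ x
      ... | yes y≈x = cong (1 *_) (φ-cong y≈x)
      ... | no  _   = refl

    ∑-fibres : ∀ (φ : Carrier → ℕ) → (∀ {x y} → x ≈ y → φ x ≡ φ y) →
               ∀ (ts : List A) (h : A → Carrier) →
               ∑ ts (φ ∘ h) ≡ ∑ elems (λ x → ∑ ts (λ t → ⟦ x ≟ h t ⟧) * φ x)
    ∑-fibres φ φ-cong ts h = begin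
      ∑ ts (φ ∘ h)                                      ≡⟨ ∑-cong ts (λ t → ∑-δ φ φ-cong (h t)) ⟨
      ∑ ts (λ t → ∑ elems (λ x → ⟦ x ≟ h t ⟧ * φ x))    ≡⟨ ∑-swap ts elems _ ⟩
      ∑ elems (λ x → ∑ ts (λ t → ⟦ x ≟ h t ⟧ * φ x))    ≡⟨ ∑-cong elems (λ x → ∑-*ʳ ts _ (φ x)) ⟩
      ∑ elems (λ x → ∑ ts (λ t → ⟦ x ≟ h t ⟧) * φ x)    ∎
      where open ≡-Reasoning

    -- Bijectivity of `h` is expressed by counting hits, so a list pieced together from several
    -- parts, such as 1, D and D⁻¹, can serve as an enumeration of the whole setoid.
    ∑-reindex : ∀ (φ : Carrier → ℕ) → (∀ {x y} → x ≈ y → φ x ≡ φ y) →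
                ∀ (ts : List A) (h : A → Carrier) →
                (∀ x → ∑ ts (λ t → ⟦ x ≟ h t ⟧) ≡ 1) →
                ∑ ts (φ ∘ h) ≡ ∑ elems φ
    ∑-reindex φ φ-cong ts h once = trans (∑-fibres φ φ-cong ts h)
      (∑-cong elems (λ x → trans (cong (_* φ x) (once x)) (*-identityˡ (φ x))))

-- Prime numbers

module _ where
  open import Data.Nat.Base hiding (_⊔_)
  open import Data.Nat.Properties hiding (_≟_)
  open import Relation.Binary.PropositionalEquality using (refl; sym; trans; subst)

  prime-≢1 : ∀ {p} → Prime p → p ≢ 1
  prime-≢1 pp refl = ¬prime[1] pp

  prime∣prime⇒≡ : ∀ {p q} → Prime p → Prime q → p ∣ q → p ≡ q
  prime∣prime⇒≡ pp pq p∣q with prime⇒irreducible pq p∣q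
  ... | inj₁ p≡1 = contradiction p≡1 (prime-≢1 pp)
  ... | inj₂ p≡q = p≡q

  prime∣^⇒∣ : ∀ {p} m n → Prime p → p ∣ m ^ n → p ∣ m
  prime∣^⇒∣ m zero    pp p∣1 = contradiction (∣1⇒≡1 p∣1) (prime-≢1 pp)
  prime∣^⇒∣ m (suc n) pp p∣  with euclidsLemma m (m ^ n) pp p∣
  ... | inj₁ p∣m = p∣m
  ... | inj₂ p∣m^n = prime∣^⇒∣ m n pp p∣m^n

  prime∣!⇒≤ : ∀ {p} n → Prime p → p ∣ n ! → p ≤ n
  prime∣!⇒≤ zero    pp p∣1 = contradiction (∣1⇒≡1 p∣1) (prime-≢1 pp)
  prime∣!⇒≤ (suc n) pp p∣ with euclidsLemma (suc n) (n !) pp p∣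
  ... | inj₁ p∣1+n = ∣⇒≤ p∣1+n
  ... | inj₂ p∣n!  = m≤n⇒m≤1+n (prime∣!⇒≤ n pp p∣n!)

  -- `p` divides p! but neither k! nor (p - k)!, whose prime factors are all smaller than `p`.
  prime∣C : ∀ {p} → Prime p → ∀ k → 0 < k → k < p → p ∣ p C k
  prime∣C {suc p} pp k 0<k k<p =
    case euclidsLemma (suc p C k) (k ! * (suc p ∸ k) !) pp
           (subst (suc p ∣_) (sym fact) (m∣m*n (p !))) of λ where
      (inj₁ p∣C) → p∣C
      (inj₂ p∣k!*) → case euclidsLemma (k !) _ pp p∣k!* of λ where
        (inj₁ p∣k!) → contradiction (prime∣!⇒≤ k pp p∣k!) (<⇒≱ k<p)
        (inj₂ p∣[p∸k]!) → contradiction (prime∣!⇒≤ _ pp p∣[p∸k]!)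
                            (<⇒≱ (∸-monoʳ-< 0<k (<⇒≤ k<p)))
    where
    instance _ = k !* (suc p ∸ k) !≢0
    fact : (suc p C k) * (k ! * (suc p ∸ k) !) ≡ suc p * p !
    fact = trans (cong (_* (k ! * (suc p ∸ k) !)) (nCk≡n!/k![n-k]! (<⇒≤ k<p)))
                 (m/n*n≡m (k![n∸k]!∣n! (<⇒≤ k<p)))

  prime-coprime : ∀ {p n} → Prime p → ¬ p ∣ n → Coprime p n
  prime-coprime pp p∤n (d∣p , d∣n) with prime⇒irreducible pp d∣p
  ... | inj₁ d≡1  = d≡1
  ... | inj₂ refl = contradiction d∣n p∤n

  -- One factor `p` is cancelled at a time: `p` is coprime to `n`, hence divides `m`.
  p^e∣m*n⇒p^e∣m : ∀ {p m n} → Prime p → ¬ p ∣ n → ∀ e → p ^ e ∣ m * n → p ^ e ∣ m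
  p^e∣m*n⇒p^e∣m         pp p∤n zero    _ = 1∣ _
  p^e∣m*n⇒p^e∣m {p} {m} {n} pp p∤n (suc e) p^∣
    with divides q refl ← coprime-divisor {o = m} (prime-coprime pp p∤n)
           (subst (p ∣_) (*-comm m n) (∣-trans (m∣m*n (p ^ e)) p^∣))
    = subst (p * p ^ e ∣_) (*-comm p q) (*-monoʳ-∣ p (p^e∣m*n⇒p^e∣m pp p∤n e
        (*-cancelˡ-∣ p {{prime⇒nonZero pp}} (subst (p * p ^ e ∣_) (lemma q p n) p^∣))))
    where
    lemma : ∀ q p n → q * p * n ≡ p * (q * n)
    lemma = solve-∀

  -- Splitting the power of one prime off a factorisation

  count : ℕ → List ℕ → ℕ
  count q xs = length (filter (q ℕ.≟_) xs)

  without : ℕ → List ℕ → List ℕ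
  without q = filter (¬? ∘ (q ℕ.≟_))

  count-accept : ∀ q xs → count q (q ∷ xs) ≡ suc (count q xs)
  count-accept q xs = cong length (filter-accept (q ℕ.≟_) {xs = xs} refl)

  count-reject : ∀ {q x} → q ≢ x → ∀ xs → count q (x ∷ xs) ≡ count q xs
  count-reject {q} q≢x xs = cong length (filter-reject (q ℕ.≟_) {xs = xs} q≢x)

  without-accept : ∀ {q x} → q ≢ x → ∀ xs → without q (x ∷ xs) ≡ x ∷ without q xs
  without-accept {q} q≢x xs = filter-accept (¬? ∘ (q ℕ.≟_)) {xs = xs} q≢x

  without-reject : ∀ q xs → without q (q ∷ xs) ≡ without q xs
  without-reject q xs = filter-reject (¬? ∘ (q ℕ.≟_)) {xs = xs} λ q≢q → q≢q refl

  product-without : ∀ q xs → product xs ≡ q ^ count q xs * product (without q xs)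
  product-without q []       = refl
  product-without q (x ∷ xs) with q ℕ.≟ x
  ... | yes refl = begin
    q * product xs
      ≡⟨ cong (q *_) (product-without q xs) ⟩
    q * (q ^ count q xs * product (without q xs))             ≡⟨ *-assoc q _ _ ⟨
    q ^ suc (count q xs) * product (without q xs)
      ≡⟨ cong₂ (λ n ys → q ^ n * product ys)
           (count-accept q xs) (without-reject q xs) ⟨
    q ^ count q (q ∷ xs) * product (without q (q ∷ xs))       ∎
    where open ≡-Reasoning
  ... | no  q≢x  = begin
    x * product xs
      ≡⟨ cong (x *_) (product-without q xs) ⟩
    x * (q ^ count q xs * product (without q xs))             ≡⟨ lemma x (q ^ count q xs) _ ⟩
    q ^ count q xs * (x * product (without q xs))
      ≡⟨ cong₂ (λ n ys → q ^ n * product ys)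
           (count-reject q≢x xs) (without-accept q≢x xs) ⟨
    q ^ count q (x ∷ xs) * product (without q (x ∷ xs))       ∎
    where
    open ≡-Reasoning
    lemma : ∀ x m n → x * (m * n) ≡ m * (x * n)
    lemma = solve-∀

  count-without : ∀ {p q} → p ≢ q → ∀ xs → count p (without q xs) ≡ count p xs
  count-without         p≢q []       = refl
  count-without {p} {q} p≢q (x ∷ xs) with q ℕ.≟ x
  ... | yes refl = begin
    count p (without q (q ∷ xs)) ≡⟨ cong (count p) (without-reject q xs) ⟩
    count p (without q xs)       ≡⟨ count-without p≢q xs ⟩
    count p xs                   ≡⟨ count-reject p≢q xs ⟨
    count p (q ∷ xs)             ∎
    where open ≡-Reasoning
  ... | no q≢x with p ℕ.≟ x
  ...   | yes refl = begin
    count p (without q (p ∷ xs)) ≡⟨ cong (count p) (without-accept q≢x xs) ⟩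
    count p (p ∷ without q xs)   ≡⟨ count-accept p _ ⟩
    suc (count p (without q xs)) ≡⟨ cong suc (count-without p≢q xs) ⟩
    suc (count p xs)             ≡⟨ count-accept p xs ⟨
    count p (p ∷ xs)             ∎
    where open ≡-Reasoning
  ...   | no  p≢x = begin
    count p (without q (x ∷ xs)) ≡⟨ cong (count p) (without-accept q≢x xs) ⟩
    count p (x ∷ without q xs)   ≡⟨ count-reject p≢x _ ⟩
    count p (without q xs)       ≡⟨ count-without p≢q xs ⟩
    count p xs                   ≡⟨ count-reject p≢x xs ⟨
    count p (x ∷ xs)             ∎
    where open ≡-Reasoning

  ∤-product-without : ∀ {p} → Prime p → ∀ {xs} → All Prime xs → ¬ p ∣ product (without p xs)
  ∤-product-without {p} pp {xs} pxs p∣ = contradiction refl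
    (All.lookup (all-filter (¬? ∘ (p ℕ.≟_)) xs)
      (factorisationHasAllPrimeFactors pp p∣ (filter⁺ (¬? ∘ (p ℕ.≟_)) pxs)))

  multiplicity-spec : ∀ {p} → Prime p → ∀ n .{{_ : NonZero n}} →
                      ∃[ w ] n ≡ p ^ multiplicity p n * w × ¬ p ∣ w
  multiplicity-spec {p} pp n = product (without p factors) ,
    trans isFactorisation (product-without p factors) , ∤-product-without pp factorsPrime
    where open PrimeFactorisation (factorise n)

  primePower : ∀ {p} → Prime p → ∀ n .{{_ : NonZero n}} →
               (∀ {q} → Prime q → q ∣ n → q ≡ p) → ∃[ k ] n ≡ p ^ k
  primePower {p} pp n unique = count p factors , trans isFactorisation
    (helper factors factorsPrime λ pq q∣ → unique pq (subst (_ ∣_) (sym isFactorisation) q∣))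
    where
    open PrimeFactorisation (factorise n)
    helper : ∀ xs → All Prime xs → (∀ {q} → Prime q → q ∣ product xs → q ≡ p) →
             product xs ≡ p ^ count p xs
    helper [] [] _ = refl
    helper (x ∷ xs) (px ∷ pxs) u with refl ← u px (m∣m*n (product xs)) = begin
      x * product xs        ≡⟨ cong (x *_) (helper xs pxs (λ pq q∣ → u pq (∣n⇒∣m*n x q∣))) ⟩
      x ^ suc (count x xs)  ≡⟨ cong (x ^_) (count-accept x xs) ⟨
      x ^ count x (x ∷ xs)  ∎
      where open ≡-Reasoning

  -- Residues modulo 4 and primes of odd multiplicity

  [mn]%4≡3 : ∀ m n → m * n % 4 ≡ 3 → (m % 4 ≡ 1 × n % 4 ≡ 3) ⊎ (m % 4 ≡ 3 × n % 4 ≡ 1)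
  [mn]%4≡3 m n e≡ = helper (m % 4) (n % 4) (m%n<n m 4) (m%n<n n 4)
                      (trans (sym (%-distribˡ-* m n 4)) e≡)
    where
    helper : ∀ r s → r < 4 → s < 4 → r * s % 4 ≡ 3 → (r ≡ 1 × s ≡ 3) ⊎ (r ≡ 3 × s ≡ 1)
    helper 1 3 _ _ _ = inj₁ (refl , refl)
    helper 3 1 _ _ _ = inj₂ (refl , refl)
    helper 0 _ _ _ ()
    helper 1 0 _ _ ()
    helper 1 1 _ _ ()
    helper 1 2 _ _ ()
    helper 2 0 _ _ ()
    helper 2 1 _ _ ()
    helper 2 2 _ _ ()
    helper 2 3 _ _ ()
    helper 3 0 _ _ ()
    helper 3 2 _ _ ()
    helper 3 3 _ _ ()
    helper 1 (suc (suc (suc (suc _)))) _ (s≤s (s≤s (s≤s (s≤s ())))) _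
    helper 2 (suc (suc (suc (suc _)))) _ (s≤s (s≤s (s≤s (s≤s ())))) _
    helper 3 (suc (suc (suc (suc _)))) _ (s≤s (s≤s (s≤s (s≤s ())))) _
    helper (suc (suc (suc (suc _)))) _ (s≤s (s≤s (s≤s (s≤s ())))) _ _

  ^-even%4 : ∀ m → m % 4 ≡ 3 → ∀ e → e % 2 ≡ 0 → m ^ e % 4 ≡ 1
  ^-even%4 m e≡ zero          _   = refl
  ^-even%4 m e≡ (suc (suc e)) e%2 = begin
    m * (m * m ^ e) % 4            ≡⟨ cong (_% 4) (*-assoc m m _) ⟨
    m * m * m ^ e % 4              ≡⟨ %-distribˡ-* (m * m) (m ^ e) 4 ⟩
    (m * m % 4) * (m ^ e % 4) % 4  ≡⟨ cong₂ (λ r s → r * s % 4) m²%4≡1 (^-even%4 m e≡ e e%2) ⟩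
    1                              ∎
    where
    open ≡-Reasoning
    m²%4≡1 : m * m % 4 ≡ 1
    m²%4≡1 = trans (%-distribˡ-* m m 4) (cong (λ r → r * r % 4) e≡)

  mod2 : ∀ n → n % 2 ≡ 0 ⊎ n % 2 ≡ 1
  mod2 n with n % 2 | m%n<n n 2
  ... | 0 | _ = inj₁ refl
  ... | 1 | _ = inj₂ refl
  ... | suc (suc _) | s≤s (s≤s ())

  ∃-odd-count : ∀ n xs → length xs ≤ n → All Prime xs → product xs % 4 ≡ 3 →
                ∃[ p ] Prime p × p % 4 ≡ 3 × p ∣ product xs × count p xs % 2 ≡ 1
  ∃-odd-count n [] _ _ ()
  ∃-odd-count (suc n) (x ∷ xs) (s≤s len) (px ∷ pxs) Π%4 with [mn]%4≡3 x (product xs) Π%4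
  ... | inj₁ (x%4≡1 , Π%4≡3) with ∃-odd-count n xs len pxs Π%4≡3
  ...   | p , pp , p%4 , p∣ , odd = p , pp , p%4 , ∣n⇒∣m*n x p∣ , trans (cong (_% 2) count≡) odd
    where
    count≡ : count p (x ∷ xs) ≡ count p xs
    count≡ = count-reject (λ where refl → case trans (sym x%4≡1) p%4 of λ ()) xs
  ∃-odd-count (suc n) (x ∷ xs) (s≤s len) (px ∷ pxs) Π%4 | inj₂ (x%4≡3 , _)
    with mod2 (count x (x ∷ xs))
  ... | inj₂ odd = x , px , x%4≡3 , m∣m*n _ , odd
  ... | inj₁ even
    with ∃-odd-count n (without x (x ∷ xs)) shorter (filter⁺ (¬? ∘ (x ℕ.≟_)) (px ∷ pxs)) rest
    where
    shorter : length (without x (x ∷ xs)) ≤ n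
    shorter = subst (λ ys → length ys ≤ n) (sym (without-reject x xs))
      (≤-trans (length-filter _ xs) len)
    -- An even power of `x` is 1 modulo 4, so the residue 3 must come from the remaining entries.
    rest : product (without x (x ∷ xs)) % 4 ≡ 3
    rest with [mn]%4≡3 (x ^ count x (x ∷ xs)) (product (without x (x ∷ xs)))
                (trans (cong (_% 4) (sym (product-without x (x ∷ xs)))) Π%4)
    ... | inj₁ (_ , e≡) = e≡
    ... | inj₂ (e≡ , _) = case trans (sym e≡) (^-even%4 x x%4≡3 (count x (x ∷ xs)) even) of λ ()
  ...   | p , pp , p%4 , p∣ , odd = p , pp , p%4 ,
          subst (p ∣_) (sym (product-without x (x ∷ xs))) (∣n⇒∣m*n (x ^ count x (x ∷ xs)) p∣) ,
          trans (cong (_% 2) (sym (count-without p≢x (x ∷ xs)))) odd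
    where
    p≢x : p ≢ x
    p≢x refl = ∤-product-without px (px ∷ pxs) p∣

  ∃-odd-multiplicity : ∀ n .{{_ : NonZero n}} → n % 4 ≡ 3 →
                       ∃[ p ] Prime p × p % 4 ≡ 3 × multiplicity p n % 2 ≡ 1
  ∃-odd-multiplicity n n%4 =
    let p , pp , p%4 , _ , odd = ∃-odd-count _ factors ≤-refl factorsPrime
          (trans (cong (_% 4) (sym isFactorisation)) n%4)
    in p , pp , p%4 , odd
    where open PrimeFactorisation (factorise n)

-- The Frobenius endomorphism

module _ {a ℓ} (S : Semiring a ℓ) where
  open Semiring S hiding (zero)
  open Mult +-monoid using ()
    renaming (_×_ to _·_; ×-assocˡ to ·-assocˡ; ×-congˡ to ·-congˡ)
  open Exp S using (_^_)
  open Sum S using (sum; sum-cong-≋; sum-init-last; sum-replicate-zero)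
  open SetoidReasoning setoid

  -- All inner binomial coefficients are multiples of `p`. Only `x` and `y` are asked to commute,
  -- because the endomorphism semiring to which this is applied need not be commutative.
  frobenius : ∀ {p} → Prime p → (∀ x → p · x ≈ 0#) →
              ∀ {x y} → x * y ≈ y * x → (x + y) ^ p ≈ x ^ p + y ^ p
  frobenius {p@(suc p′)} pp char {x} {y} xy≈yx = begin
    (x + y) ^ p
      ≈⟨ Binomial.theorem S x y xy≈yx p ⟩
    t zero + sum (t ∘ suc)
      ≈⟨ +-cong first (sum-init-last (t ∘ suc)) ⟩
    y ^ p + (sum middle + t (suc (Fin.fromℕ p′)))
      ≈⟨ +-congˡ (+-cong (trans (sum-cong-≋ middle≈0) (sum-replicate-zero p′)) last) ⟩
    y ^ p + (0# + x ^ p)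
      ≈⟨ +-congˡ (+-identityˡ _) ⟩
    y ^ p + x ^ p
      ≈⟨ +-comm _ _ ⟩
    x ^ p + y ^ p ∎
    where
    t : Fin (suc p) → Carrier
    t = Binomial.binomialTerm S x y p

    middle : Fin p′ → Carrier
    middle i = t (suc (Fin.inject₁ i))

    first : t zero ≈ y ^ p
    first = trans (+-identityʳ _) (*-identityˡ _)

    last : t (suc (Fin.fromℕ p′)) ≈ x ^ p
    last rewrite Fin.toℕ-fromℕ p′ | nCn≡1 p | ℕ.n∸n≡0 p′ = trans (+-identityʳ _) (*-identityʳ _)

    middle≈0 : ∀ i → middle i ≈ 0#
    middle≈0 i with divides q C≡q*p ← prime∣C pp (suc (toℕ (Fin.inject₁ i))) z<s
                      (s<s (≡.subst (ℕ._< p′) (≡.sym (Fin.toℕ-inject₁ i)) (Fin.toℕ<n i))) = begin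
      middle i       ≈⟨ ·-congˡ (≡.trans C≡q*p (ℕ.*-comm q p)) ⟩
      (p ℕ.* q) · z  ≈⟨ ·-assocˡ z p q ⟨
      p · (q · z)    ≈⟨ char (q · z) ⟩
      0#             ∎
      where z = Binomial.binomial S x y p (suc (Fin.inject₁ i))

-- Lists of group elements will act as additive maps. Under composition these form a semiring in
-- which associativity and one distributive law hold by definition, so the binomial theorem becomes
-- available for lists without a product of lists.
module Endomorphisms {a ℓ} (M : CommutativeMonoid a ℓ) where
  open CommutativeMonoid M renaming (_∙_ to _+_; ε to 0#)
  open CommutativeSemigroupProperties commutativeSemigroup using (interchange)

  record Endo : Set (a ⊔ ℓ) where
    field
      apply  : Carrier → Carrier
      congr  : ∀ {x y} → x ≈ y → apply x ≈ apply y
      homo-+ : ∀ x y → apply (x + y) ≈ apply x + apply y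
      homo-0 : apply 0# ≈ 0#
  open Endo public

  semiring : Semiring (a ⊔ ℓ) (a ⊔ ℓ)
  semiring = record
    { Carrier = Endo
    ; _≈_ = λ f g → ∀ x → apply f x ≈ apply g x
    ; _+_ = λ f g → record
      { apply  = λ x → apply f x + apply g x
      ; congr  = λ x≈y → ∙-cong (congr f x≈y) (congr g x≈y)
      ; homo-+ = λ x y → trans (∙-cong (homo-+ f x y) (homo-+ g x y)) (interchange _ _ _ _)
      ; homo-0 = trans (∙-cong (homo-0 f) (homo-0 g)) (identityˡ 0#)
      }
    ; _*_ = λ f g → record
      { apply  = λ x → apply f (apply g x)
      ; congr  = λ x≈y → congr f (congr g x≈y)
      ; homo-+ = λ x y → trans (congr f (homo-+ g x y)) (homo-+ f _ _)
      ; homo-0 = trans (congr f (homo-0 g)) (homo-0 f)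
      }
    ; 0# = record
      { apply  = λ _ → 0#
      ; congr  = λ _ → refl
      ; homo-+ = λ _ _ → sym (identityˡ 0#)
      ; homo-0 = refl
      }
    ; 1# = record
      { apply  = λ x → x
      ; congr  = λ x≈y → x≈y
      ; homo-+ = λ _ _ → refl
      ; homo-0 = refl
      }
    ; isSemiring = record
      { isSemiringWithoutAnnihilatingZero = record
        { +-isCommutativeMonoid = record
          { isMonoid = record
            { isSemigroup = record
              { isMagma = record
                { isEquivalence = record
                  { refl  = λ _ → refl
                  ; sym   = λ f≈g x → sym (f≈g x)
                  ; trans = λ f≈g g≈h x → trans (f≈g x) (g≈h x)
                  }
                ; ∙-cong = λ f≈g h≈k x → ∙-cong (f≈g x) (h≈k x)
                }
              ; assoc = λ _ _ _ _ → assoc _ _ _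
              }
            ; identity = (λ _ _ → identityˡ _) , (λ _ _ → identityʳ _)
            }
          ; comm = λ _ _ _ → comm _ _
          }
        ; *-cong = λ {f} f≈g h≈k x → trans (congr f (h≈k x)) (f≈g _)
        ; *-assoc = λ _ _ _ _ → refl
        ; *-identity = (λ _ _ → refl) , (λ _ _ → refl)
        ; distrib = (λ f _ _ _ → homo-+ f _ _) , (λ _ _ _ _ → refl)
        }
      ; zero = (λ _ _ → refl) , (λ f _ → homo-0 f)
      }
    }

-- Finite setoids and finite groups

module _ {S : Setoid c ℓ} {n : ℕ} where
  open Setoid S

  mkHasSize : (to : Carrier → Fin n) (from : Fin n → Carrier) →
              (∀ {x y} → x ≈ y → to x ≡ to y) →
              (∀ i → to (from i) ≡ i) → (∀ x → from (to x) ≈ x) → S HasSize n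
  mkHasSize to from to-cong to∘from from∘to = record
    { to        = to
    ; from      = from
    ; to-cong   = to-cong
    ; from-cong = λ where ≡.refl → refl
    ; inverse   = (λ x≈from → ≡.trans (to-cong x≈from) (to∘from _))
                , λ where ≡.refl → from∘to _
    }

-- Induction on `n`: the point `zero` either joins the class of a later point or is a class of its
-- own, and decidability tells which.
Fin-quotient : ∀ n {_~_ : Rel (Fin n) r} (isEq : IsEquivalence _~_) → Decidable _~_ →
               ∃[ m ] record { isEquivalence = isEq } HasSize m
Fin-quotient zero    isEq _~?_ = 0 , mkHasSize (λ ()) (λ ()) (λ { {()} }) (λ ()) (λ ())
Fin-quotient (suc n) {_~_} isEq _~?_
  with Fin-quotient n (On.isEquivalence suc isEq) (λ i j → suc i ~? suc j)
     | Fin.any? (λ j → zero ~? suc j)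
... | m , hasSize | yes (j , 0~j) =
  m , mkHasSize to (suc ∘ I.from) to-cong I.strictlyInverseˡ from∘to
  where
  module I = Inverse hasSize
  module ~ = IsEquivalence isEq

  to : Fin (suc n) → Fin m
  to zero    = I.to j
  to (suc i) = I.to i

  to-cong : ∀ {x y} → x ~ y → to x ≡ to y
  to-cong {zero}  {zero}  _   = ≡.refl
  to-cong {zero}  {suc y} 0~y = I.to-cong (~.trans (~.sym 0~j) 0~y)
  to-cong {suc x} {zero}  x~0 = I.to-cong (~.trans x~0 0~j)
  to-cong {suc x} {suc y} x~y = I.to-cong x~y

  from∘to : ∀ x → suc (I.from (to x)) ~ x
  from∘to zero    = ~.trans (I.strictlyInverseʳ j) (~.sym 0~j)
  from∘to (suc x) = I.strictlyInverseʳ x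
... | m , hasSize | no 0≁ = suc m , mkHasSize to from to-cong to∘from from∘to
  where
  module I = Inverse hasSize
  module ~ = IsEquivalence isEq

  to : Fin (suc n) → Fin (suc m)
  to zero    = zero
  to (suc i) = suc (I.to i)

  from : Fin (suc m) → Fin (suc n)
  from zero    = zero
  from (suc i) = suc (I.from i)

  to-cong : ∀ {x y} → x ~ y → to x ≡ to y
  to-cong {zero}  {zero}  _   = ≡.refl
  to-cong {zero}  {suc y} 0~y = contradiction (y , 0~y) 0≁
  to-cong {suc x} {zero}  x~0 = contradiction (x , ~.sym x~0) 0≁
  to-cong {suc x} {suc y} x~y = ≡.cong suc (I.to-cong x~y)

  to∘from : ∀ i → to (from i) ≡ i
  to∘from zero    = ≡.refl
  to∘from (suc i) = ≡.cong suc (I.strictlyInverseˡ i)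

  from∘to : ∀ x → from (to x) ~ x
  from∘to zero    = ~.refl
  from∘to (suc x) = I.strictlyInverseʳ x

module _ {S : Setoid c ℓ} {n} (hasSize : S HasSize n) where
  open Setoid S using (Carrier; _≈_)
  private
    module I = Inverse hasSize

  quotient-hasSize : ∀ {_~_ : Rel Carrier r} (isEq : IsEquivalence _~_) →
                     (∀ {x y} → x ≈ y → x ~ y) → Decidable _~_ →
                     ∃[ m ] record { isEquivalence = isEq } HasSize m
  quotient-hasSize isEq ≈⇒~ _~?_
    with m , hasSize′ ← Fin-quotient n (On.isEquivalence I.from isEq)
                          (λ i j → I.from i ~? I.from j) =
    m , mkHasSize (J.to ∘ I.to) (I.from ∘ J.from)
        (λ {x} {y} x~y → J.to-cong (~.trans (from∘to x) (~.trans x~y (~.sym (from∘to y)))))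
        (λ i → ≡.trans (≡.cong J.to (I.strictlyInverseˡ (J.from i))) (J.strictlyInverseˡ i))
        (λ x → ~.trans (J.strictlyInverseʳ (I.to x)) (from∘to x))
    where
    module J = Inverse hasSize′
    module ~ = IsEquivalence isEq
    from∘to = λ x → ≈⇒~ (I.strictlyInverseʳ x)

-- Decidability of generated subgroups and the size of the abelianisation

module _ (G : FiniteGroup c ℓ) where
  open FiniteGroup G
  open Inverse hasSize using (to; from; to-cong; strictlyInverseʳ)
  open Enumeration hasSize using (_≟_)

  ∃? : ∀ {P : Pred Carrier p} → P Respects _≈_ → Decidable₁ P → Dec (∃[ x ] P x)
  ∃? resp P? = Dec.map′ (λ (i , Pi) → from i , Pi)
    (λ (x , Px) → to x , resp (sym (strictlyInverseʳ x)) Px) (Fin.any? (P? ∘ from))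

  module _ {P : Pred Carrier p} (P-resp : P Respects _≈_) (P? : Decidable₁ P) where
    private
      Step : FinSubset.Subset order → Pred (Fin order) (p ⊔ ℓ)
      Step S i = from i ∈ P ⊎ from i ≈ ε
               ⊎ (∃[ j ] ∃[ k ] (j FinSubset.∈ S × k FinSubset.∈ S × from i ≈ from j ∙ from k))
               ⊎ (∃[ j ] (j FinSubset.∈ S × from i ≈ from j ⁻¹))

      Step? : ∀ S → Decidable₁ (Step S)
      Step? S i = P? (from i) ⊎-dec from i ≟ ε
        ⊎-dec Fin.any? (λ j → Fin.any? λ k →
                j FinSubset.∈? S ×-dec k FinSubset.∈? S ×-dec from i ≟ from j ∙ from k)
        ⊎-dec Fin.any? (λ j → j FinSubset.∈? S ×-dec from i ≟ from j ⁻¹)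

      Inside : FinSubset.Subset order → Set _
      Inside S = ∀ {i} → i FinSubset.∈ S → from i ∈ ⟨_⟩ group P

      step-inside : ∀ {S} → Inside S → ∀ {i} → Step S i → from i ∈ ⟨_⟩ group P
      step-inside inS (inj₁ i∈P) = gen i∈P
      step-inside inS (inj₂ (inj₁ i≈ε)) = eq (sym i≈ε) unit
      step-inside inS (inj₂ (inj₂ (inj₁ (j , k , j∈S , k∈S , i≈jk)))) =
        eq (sym i≈jk) (mult (inS j∈S) (inS k∈S))
      step-inside inS (inj₂ (inj₂ (inj₂ (j , j∈S , i≈j⁻¹)))) = eq (sym i≈j⁻¹) (inv (inS j∈S))

      saturated-complete : ∀ {S} → (∀ i → Step S i → i FinSubset.∈ S) →
                           ∀ {x} → x ∈ ⟨_⟩ group P → to x FinSubset.∈ S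
      saturated-complete sat (gen {x} x∈P) = sat _ (inj₁ (P-resp (sym (strictlyInverseʳ x)) x∈P))
      saturated-complete {S} sat (eq x≈y x∈) =
        ≡.subst (FinSubset._∈ S) (to-cong x≈y) (saturated-complete sat x∈)
      saturated-complete sat unit = sat _ (inj₂ (inj₁ (strictlyInverseʳ ε)))
      saturated-complete sat (mult {x} {y} x∈ y∈) = sat _ (inj₂ (inj₂ (inj₁ (_ , _ ,
        saturated-complete sat x∈ , saturated-complete sat y∈ ,
        trans (strictlyInverseʳ (x ∙ y)) (sym (∙-cong (strictlyInverseʳ x) (strictlyInverseʳ y)))))))
      saturated-complete sat (inv {x} x∈) = sat _ (inj₂ (inj₂ (inj₂ (_ , saturated-complete sat x∈ ,
        trans (strictlyInverseʳ (x ⁻¹)) (sym (⁻¹-cong (strictlyInverseʳ x)))))))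

      -- `S` grows by a point that is one closure step away, and strict growth inside a finite set
      -- is well founded. `Inside` keeps `S` within the generated subgroup; once no step leads out
      -- of `S`, `saturated-complete` gives the other inclusion.
      saturate : ∀ S → Acc FinSubset._⊃_ S → Inside S → Decidable₁ (⟨_⟩ group P)
      saturate S (acc larger) inS with Fin.any? (λ i → ¬? (i FinSubset.∈? S) ×-dec Step? S i)
      ... | yes (i , i∉S , step) = saturate (FinSubset.⁅ i ⁆ FinSubset.∪ S)
              (larger (FinSubset.q⊆p∪q FinSubset.⁅ i ⁆ S , i ,
                       FinSubset.p⊆p∪q S (FinSubset.x∈⁅x⁆ i) , i∉S)) inside
        where
        inside : Inside (FinSubset.⁅ i ⁆ FinSubset.∪ S)
        inside j∈ with FinSubset.x∈p∪q⁻ FinSubset.⁅ i ⁆ S j∈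
        ... | inj₁ j∈⁅i⁆ with ≡.refl ← FinSubset.x∈⁅y⁆⇒x≡y i j∈⁅i⁆ = step-inside inS step
        ... | inj₂ j∈S = inS j∈S
      ... | no saturated = λ x → Dec.map′ (λ x∈S → eq (strictlyInverseʳ x) (inS x∈S))
              (saturated-complete λ i step → decidable-stable (i FinSubset.∈? S)
                λ i∉S → saturated (i , i∉S , step))
              (to x FinSubset.∈? S)

    ⟨⟩-decidable : Decidable₁ (⟨_⟩ group P)
    ⟨⟩-decidable = saturate FinSubset.⊥ (⊃-wellFounded _) (λ i∈⊥ → contradiction i∈⊥ FinSubset.∉⊥)

  isCommutator-resp : IsCommutator group Respects _≈_
  isCommutator-resp x≈y (g , h , x≈) = g , h , trans (sym x≈y) x≈

  isCommutator? : Decidable₁ (IsCommutator group)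
  isCommutator? z = ∃?
    (λ x≈y (h , z≈) → h , trans z≈ (∙-cong (∙-congʳ (⁻¹-cong x≈y)) (∙-congʳ x≈y)))
    λ g → ∃? (λ x≈y z≈ → trans z≈ (∙-cong (∙-congˡ (⁻¹-cong x≈y)) (∙-congˡ x≈y)))
    λ h → z ≟ (g ⁻¹ ∙ h ⁻¹) ∙ (g ∙ h)

  commutatorSubgroup? : Decidable₁ (CommutatorSubgroup group)
  commutatorSubgroup? = ⟨⟩-decidable isCommutator-resp isCommutator?

  -- The second statement of the theorem has to produce the index of G′, whereas the first receives
  -- it. Counting cosets constructively requires a decision of membership in G′.
  abelianisation-hasSize : ∃[ m ] Index group (commutator-isSubgroup group) m
  abelianisation-hasSize = quotient-hasSize hasSize
    (Setoid.isEquivalence (leftCosets group (commutator-isSubgroup group)))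
    (λ {x} x≈y → eq (trans (sym (inverseˡ x)) (∙-congˡ x≈y)) unit)
    (λ x y → commutatorSubgroup? (x ⁻¹ ∙ y))

-- Abelian groups and their group rings

module _ (A : AbelianGroup c ℓ) where
  open AbelianGroup A
  open GroupProperties group
  open CommutativeSum commutativeMonoid
  open Mult monoid using () renaming (_×_ to _·_)
  open SetoidReasoning setoid

  -- Translation by x permutes the factors of the product of all elements.
  order-annihilates : ∀ {n} → setoid HasSize n → ∀ x → n · x ≈ ε
  order-annihilates {n} hasSize x = identityˡ-unique (n · x) (sum from) (begin
    n · x ∙ sum from                        ≈⟨ ∙-congʳ (sum-replicate n) ⟨
    sum {n} (λ _ → x) ∙ sum from            ≈⟨ ∑-distrib-+ (λ _ → x) from ⟨
    sum (λ i → x ∙ from i)                  ≈⟨ sum-cong-≋ (λ i → strictlyInverseʳ (x ∙ from i)) ⟨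
    sum (λ i → from (to (x ∙ from i)))      ≈⟨ sum-permute from translate ⟨
    sum from                                ∎)
    where
    open Inverse hasSize using (to; from; to-cong; strictlyInverseˡ; strictlyInverseʳ)
    cancel : ∀ y z → y ∙ z ≈ ε → ∀ i → to (y ∙ from (to (z ∙ from i))) ≡ i
    cancel y z yz≈ε i = ≡.trans (to-cong (begin
      y ∙ from (to (z ∙ from i)) ≈⟨ ∙-congˡ (strictlyInverseʳ (z ∙ from i)) ⟩
      y ∙ (z ∙ from i)           ≈⟨ assoc y z (from i) ⟨
      y ∙ z ∙ from i             ≈⟨ ∙-congʳ yz≈ε ⟩
      ε ∙ from i                 ≈⟨ identityˡ (from i) ⟩
      from i                     ∎)) (strictlyInverseˡ i)

    translate : Permutation n n
    translate = permutation (λ i → to (x ∙ from i)) (λ i → to (x ⁻¹ ∙ from i))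
      (cancel x (x ⁻¹) (inverseʳ x)) (cancel (x ⁻¹) x (inverseˡ x))

module _ (A : AbelianGroup a ℓ) where
  open AbelianGroup A
  open GroupProperties group
  open import Data.Nat.Base using (_*_)
  open CommutativeMult commutativeMonoid using () renaming (×-distrib-+ to ·-distrib-∙)
  open Mult monoid using ()
    renaming (_×_ to _·_; ×-congʳ to ·-congʳ; ×-congˡ to ·-congˡ; ×-assocˡ to ·-assocˡ)

  ·-ε : ∀ n → n · ε ≈ ε
  ·-ε zero    = refl
  ·-ε (suc n) = trans (identityˡ _) (·-ε n)

  ·-⁻¹ : ∀ n x → n · (x ⁻¹) ≈ (n · x) ⁻¹
  ·-⁻¹ n x = inverseˡ-unique (n · (x ⁻¹)) (n · x)
    (trans (sym (·-distrib-∙ (x ⁻¹) x n)) (trans (·-congʳ n (inverseˡ x)) (·-ε n)))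

  ∣⇒·≈ε : ∀ {m n x} → m ∣ n → m · x ≈ ε → n · x ≈ ε
  ∣⇒·≈ε {m} {x = x} (divides q ≡.refl) mx≈ε =
    trans (sym (·-assocˡ x q m)) (trans (·-congʳ q mx≈ε) (·-ε q))

  -- Bézout's identity over ℕ comes in two forms, according to the side on which the 1 stands.
  -- Either way `x` plus a vanishing multiple is a vanishing multiple.
  coprime-annihilators : ∀ {m n x} → Coprime m n → m · x ≈ ε → n · x ≈ ε → x ≈ ε
  coprime-annihilators {m} {n} {x} m⊥n mx≈ε nx≈ε with coprime-Bézout m⊥n
  ... | Bézout.+- i j 1+jn≡im = begin
    x                     ≈⟨ identityʳ x ⟨
    x ∙ ε                 ≈⟨ ∙-congˡ (∣⇒·≈ε (n∣m*n j) nx≈ε) ⟨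
    suc (j * n) · x       ≈⟨ ·-congˡ 1+jn≡im ⟩
    (i * m) · x           ≈⟨ ∣⇒·≈ε (n∣m*n i) mx≈ε ⟩
    ε                     ∎
    where open SetoidReasoning setoid
  ... | Bézout.-+ i j 1+im≡jn = begin
    x                     ≈⟨ identityʳ x ⟨
    x ∙ ε                 ≈⟨ ∙-congˡ (∣⇒·≈ε (n∣m*n i) mx≈ε) ⟨
    suc (i * m) · x       ≈⟨ ·-congˡ 1+im≡jn ⟩
    (j * n) · x           ≈⟨ ∣⇒·≈ε (n∣m*n j) nx≈ε ⟩
    ε                     ∎
    where open SetoidReasoning setoid

  -- The quotient by the kernel of multiplication by `k`. Two elements are congruent modulo this
  -- kernel exactly when their `k`-fold multiples agree, so no cosets are needed and the projection
  -- is the identity on carriers.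
  quotientByTorsion : ℕ → AbelianGroup a ℓ
  quotientByTorsion k = record
    { Carrier = Carrier
    ; _≈_ = λ x y → k · x ≈ k · y
    ; _∙_ = _∙_
    ; ε = ε
    ; _⁻¹ = _⁻¹
    ; isAbelianGroup = record
      { isGroup = record
        { isMonoid = record
          { isSemigroup = record
            { isMagma = record
              { isEquivalence = On.isEquivalence (k ·_) isEquivalence
              ; ∙-cong = λ {x} {y} {u} {v} x≈y u≈v →
                  trans (·-distrib-∙ x u k) (trans (∙-cong x≈y u≈v) (sym (·-distrib-∙ y v k)))
              }
            ; assoc = λ x y z → ·-congʳ k (assoc x y z)
            }
          ; identity = (λ x → ·-congʳ k (identityˡ x)) , (λ x → ·-congʳ k (identityʳ x))
          }
        ; inverse = (λ x → ·-congʳ k (inverseˡ x)) , (λ x → ·-congʳ k (inverseʳ x))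
        ; ⁻¹-cong = λ {x} {y} x≈y → trans (·-⁻¹ k x) (trans (⁻¹-cong x≈y) (sym (·-⁻¹ k y)))
        }
      ; comm = λ x y → ·-congʳ k (comm x y)
      }
    }

-- The integral group ring of B with non-negative coefficients: a list L stands
-- for the sum of its entries, acting on functions B → ℕ by translation.
module GroupRing {a ℓ} (B : AbelianGroup a ℓ) (_≟_ : Decidable (AbelianGroup._≈_ B)) where
  open AbelianGroup B
  open GroupProperties group
  open Mult monoid using () renaming (_×_ to _·_; ×-congʳ to ·-congʳ)
  open CommutativeMult commutativeMonoid using () renaming (×-distrib-+ to ·-distrib-∙)
  open CommutativeSemigroupProperties (CommutativeMonoid.commutativeSemigroup commutativeMonoid)
    using (xy∙z≈xz∙y)

  Respects : (Carrier → ℕ) → Set (a ⊔ ℓ)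
  Respects φ = ∀ {x y} → x ≈ y → φ x ≡ φ y

  conv : List Carrier → (Carrier → ℕ) → Carrier → ℕ
  conv L φ x = ∑ L (λ g → φ (x ∙ g))

  conv-resp : ∀ L {φ} → Respects φ → Respects (conv L φ)
  conv-resp L φ-resp x≈y = ∑-cong L (λ g → φ-resp (∙-congʳ x≈y))

  conv-*ˡ : ∀ L k φ x → conv L (λ y → k ℕ.* φ y) x ≡ k ℕ.* conv L φ x
  conv-*ˡ L k φ x = ∑-*ˡ L k _

  conv-comm : ∀ L L′ {φ} → Respects φ → ∀ x → conv L (conv L′ φ) x ≡ conv L′ (conv L φ) x
  conv-comm L L′ φ-resp x = ≡.trans (∑-swap L L′ _)
    (∑-cong L′ λ h → ∑-cong L λ g → φ-resp (xy∙z≈xz∙y x g h))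

  δ : Carrier → ℕ
  δ x = ⟦ x ≟ ε ⟧

  δ-resp : Respects δ
  δ-resp {x} {y} x≈y = ⟦⟧-cong (x ≟ ε) (y ≟ ε) (trans (sym x≈y)) (trans x≈y)

  -- By the convention of `conv`, the value at `x` is the coefficient of `x ⁻¹` in `L`, respectively
  -- in `L²`. Statements about all coefficients do not see this inversion.
  coeff coeff² : List Carrier → Carrier → ℕ
  coeff  L = conv L δ
  coeff² L = conv L (coeff L)

  TorsionFree : ℕ → Set (a ⊔ ℓ)
  TorsionFree n = ∀ x → n · x ≈ ε → x ≈ ε

  -- The group ring modulo a prime

  module _ {p} (pp : Prime p) where
    private instance
      _ = prime⇒nonZero pp
      _ = prime⇒nonTrivial pp

    private
      -- The functions from `B` to ℤ/p. Reduction takes place in the equality only, so values remain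
      -- natural numbers and can be compared with `conv` directly.
      residues : CommutativeMonoid (a ⊔ ℓ) a
      residues = record
        { Carrier = Σ[ φ ∈ (Carrier → ℕ) ] Respects φ
        ; _≈_ = λ φ ψ → ∀ x → proj₁ φ x % p ≡ proj₁ ψ x % p
        ; _∙_ = λ φ ψ → (λ x → proj₁ φ x ℕ.+ proj₁ ψ x) ,
                        λ x≈y → ≡.cong₂ ℕ._+_ (proj₂ φ x≈y) (proj₂ ψ x≈y)
        ; ε = (λ _ → 0) , λ _ → ≡.refl
        ; isCommutativeMonoid = record
          { isMonoid = record
            { isSemigroup = record
              { isMagma = record
                { isEquivalence = record
                  { refl  = λ _ → ≡.refl
                  ; sym   = λ φ≈ψ x → ≡.sym (φ≈ψ x)
                  ; trans = λ φ≈ψ ψ≈χ x → ≡.trans (φ≈ψ x) (ψ≈χ x)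
                  }
                ; ∙-cong = λ {φ} {ψ} {φ′} {ψ′} φ≈ψ φ′≈ψ′ x → begin
                    (proj₁ φ x ℕ.+ proj₁ φ′ x) % p             ≡⟨ %-distribˡ-+ (proj₁ φ x) _ p ⟩
                    (proj₁ φ x % p ℕ.+ proj₁ φ′ x % p) % p     ≡⟨ ≡.cong₂ (λ m n → (m ℕ.+ n) % p)
                                                                        (φ≈ψ x) (φ′≈ψ′ x) ⟩
                    (proj₁ ψ x % p ℕ.+ proj₁ ψ′ x % p) % p     ≡⟨ %-distribˡ-+ (proj₁ ψ x) _ p ⟨
                    (proj₁ ψ x ℕ.+ proj₁ ψ′ x) % p             ∎
                }
              ; assoc = λ φ ψ χ x → ≡.cong (_% p) (ℕ.+-assoc (proj₁ φ x) _ _)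
              }
            ; identity = (λ _ _ → ≡.refl) , (λ φ x → ≡.cong (_% p) (ℕ.+-identityʳ _))
            }
          ; comm = λ φ ψ x → ≡.cong (_% p) (ℕ.+-comm (proj₁ φ x) _)
          }
        }
        where open ≡-Reasoning

      open Endomorphisms residues
      module E = Semiring semiring
      open Exp semiring using (_^_)
      open Mult E.+-monoid using () renaming (_×_ to _×E_)

      translation : Carrier → Endo
      translation g = record
        { apply  = λ φ → (λ x → proj₁ φ (x ∙ g)) , λ x≈y → proj₂ φ (∙-congʳ x≈y)
        ; congr  = λ φ≈ψ x → φ≈ψ (x ∙ g)
        ; homo-+ = λ _ _ _ → ≡.refl
        ; homo-0 = λ _ → ≡.refl
        }

      action : List Carrier → Endo
      action []      = E.0#
      action (g ∷ L) = translation g E.+ action L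

      action-conv : ∀ L φ x → proj₁ (apply (action L) φ) x ≡ conv L (proj₁ φ) x
      action-conv []      φ x = ≡.refl
      action-conv (g ∷ L) φ x = ≡.cong (proj₁ φ (x ∙ g) ℕ.+_) (action-conv L φ x)

      -- This is where commutativity of `B` supplies the hypothesis of `frobenius`.
      translation-action : ∀ g L → translation g E.* action L E.≈ action L E.* translation g
      translation-action g L φ x = ≡.cong (_% p) (begin
        proj₁ (apply (action L) φ) (x ∙ g)  ≡⟨ action-conv L φ (x ∙ g) ⟩
        ∑ L (λ h → proj₁ φ (x ∙ g ∙ h))     ≡⟨ ∑-cong L (λ h → proj₂ φ (xy∙z≈xz∙y x g h)) ⟩
        ∑ L (λ h → proj₁ φ (x ∙ h ∙ g))     ≡⟨ action-conv L (apply (translation g) φ) x ⟨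
        proj₁ (apply (action L) (apply (translation g) φ)) x ∎)
        where open ≡-Reasoning

      apply-× : ∀ n f φ x → proj₁ (apply (n ×E f) φ) x ≡ n ℕ.* proj₁ (apply f φ) x
      apply-× zero    f φ x = ≡.refl
      apply-× (suc n) f φ x = ≡.cong (proj₁ (apply f φ) x ℕ.+_) (apply-× n f φ x)

      characteristic : ∀ f → p ×E f E.≈ E.0#
      characteristic f φ x = begin
        proj₁ (apply (p ×E f) φ) x % p   ≡⟨ ≡.cong (_% p) (apply-× p f φ x) ⟩
        p ℕ.* proj₁ (apply f φ) x % p    ≡⟨ n∣m⇒m%n≡0 _ p (m∣m*n _) ⟩
        0                                ≡⟨ n∣m⇒m%n≡0 0 p (p ∣0) ⟨
        0 % p                            ∎
        where open ≡-Reasoning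

      translation-^ : ∀ g n φ x → proj₁ (apply (translation g ^ n) φ) x ≡ proj₁ φ (x ∙ (n · g))
      translation-^ g zero    φ x = proj₂ φ (sym (identityʳ x))
      translation-^ g (suc n) φ x =
        ≡.trans (translation-^ g n φ (x ∙ g)) (proj₂ φ (assoc x g (n · g)))

      action-frobenius : ∀ L → action L ^ p E.≈ action (map (p ·_) L)
      action-frobenius []      = 0^ p
        where
        -- The exponent has to be nonzero, since the zeroth power of `0#` is `1#`.
        0^ : ∀ n .{{_ : NonZero n}} → E.0# ^ n E.≈ E.0#
        0^ (suc n) = E.zeroˡ (E.0# ^ n)
      action-frobenius (g ∷ L) = begin
        (translation g E.+ action L) ^ p
          ≈⟨ frobenius semiring pp characteristic (translation-action g L) ⟩
        translation g ^ p E.+ action L ^ p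
          ≈⟨ E.+-cong {translation g ^ p} {translation (p · g)}
                      {action L ^ p} {action (map (p ·_) L)}
               (λ φ x → ≡.cong (_% p) (translation-^ g p φ x)) (action-frobenius L) ⟩
        translation (p · g) E.+ action (map (p ·_) L) ∎
        where open SetoidReasoning E.setoid

    -- Modulo p, the p-th power of L is the list of the p-th powers of the
    -- entries of L, so that the group ring modulo p has no nilpotents when
    -- g ↦ gᵖ is injective.
    p∣coeff²⇒p∣coeff : TorsionFree p → ∀ L → (∀ x → p ∣ coeff² L x) → ∀ x → p ∣ coeff L x
    p∣coeff²⇒p∣coeff torsionFree L p∣coeff² h = m%n≡0⇒n∣m (coeff L h) p (begin
      coeff L h % p
        ≡⟨ ≡.cong (_% p) (∑-cong L λ g →
             ⟦⟧-cong ((h ∙ g) ≟ ε) (((p · h) ∙ (p · g)) ≟ ε) (to g) (from g)) ⟩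
      ∑ L (λ g → δ ((p · h) ∙ (p · g))) % p
        ≡⟨ ≡.cong (_% p) (∑-map (p ·_) L (λ g → δ ((p · h) ∙ g))) ⟨
      conv (map (p ·_) L) δ (p · h) % p
        ≡⟨ ≡.cong (_% p) (action-conv (map (p ·_) L) δ′ (p · h)) ⟨
      proj₁ (apply (action (map (p ·_) L)) δ′) (p · h) % p
        ≡⟨ action-frobenius L δ′ (p · h) ⟨
      proj₁ (apply (action L ^ p) δ′) (p · h) % p
        ≡⟨ power≈0 p (ℕ.nonTrivial⇒n>1 p) (p · h) ⟩
      0 % p
        ≡⟨ n∣m⇒m%n≡0 0 p (p ∣0) ⟩
      0 ∎)
      where
      open ≡-Reasoning
      δ′ : Σ[ φ ∈ (Carrier → ℕ) ] Respects φ
      δ′ = δ , δ-resp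

      to : ∀ g → h ∙ g ≈ ε → (p · h) ∙ (p · g) ≈ ε
      to g hg≈ε = trans (sym (·-distrib-∙ h g p)) (trans (·-congʳ p hg≈ε) (·-ε B p))

      from : ∀ g → (p · h) ∙ (p · g) ≈ ε → h ∙ g ≈ ε
      from g e = torsionFree (h ∙ g) (trans (·-distrib-∙ h g p) e)

      -- The hypothesis on `coeff²` is the case of exponent 2. Higher powers apply `action L` to a
      -- function that already vanishes modulo `p`, and every prime is at least 2.
      power≈0 : ∀ n → 1 ℕ.< n → ∀ x → proj₁ (apply (action L ^ n) δ′) x % p ≡ 0 % p
      power≈0 (suc (suc zero)) _ x = begin
        proj₁ (apply (action L) (apply (action L) δ′)) x % p
          ≡⟨ ≡.cong (_% p) (action-conv L (apply (action L) δ′) x) ⟩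
        conv L (proj₁ (apply (action L) δ′)) x % p
          ≡⟨ ≡.cong (_% p) (∑-cong L λ g → action-conv L δ′ (x ∙ g)) ⟩
        coeff² L x % p
          ≡⟨ n∣m⇒m%n≡0 _ p (p∣coeff² x) ⟩
        0
          ≡⟨ n∣m⇒m%n≡0 0 p (p ∣0) ⟨
        0 % p ∎
      power≈0 (suc (suc (suc n))) _ x =
        ≡.trans (congr (action L) {y = (λ _ → 0) , λ _ → ≡.refl}
                  (power≈0 (suc (suc n)) (ℕ.s≤s (ℕ.s≤s ℕ.z≤n))) x)
                (homo-0 (action L) x)
      power≈0 (suc zero) (ℕ.s≤s ()) x

    module _ {n} (hasSize : setoid HasSize n) (torsionFree : TorsionFree p) where
      private
        open module S = Enumeration hasSize using (elems; ∑-δ; ∑-≟; ∑-1)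

      δ-∙ : ∀ x g → δ (x ∙ g) ≡ ⟦ g S.≟ x ⁻¹ ⟧
      δ-∙ x g = ⟦⟧-cong ((x ∙ g) ≟ ε) (g S.≟ x ⁻¹)
        (inverseʳ-unique x g) (λ e → trans (∙-congˡ e) (inverseʳ x))

      -- The quotient is realised as a list by repeating each group element according to its
      -- coefficient divided by `p`.
      divide : ∀ L → (∀ x → p ∣ coeff L x) → ∃[ L′ ] ∀ x → coeff L x ≡ p ℕ.* coeff L′ x
      divide L p∣coeff = L′ , λ x →
        ≡.trans (≡.sym (m*[n/m]≡n (p∣coeff x))) (≡.cong (p ℕ.*_) (≡.sym (coeff-L′ x)))
        where
        open ≡-Reasoning
        -- The inverse undoes the one hidden in `coeff`: this is the coefficient of `g` itself,
        -- divided by `p`.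
        m : Carrier → ℕ
        m g = coeff L (g ⁻¹) / p

        L′ : List Carrier
        L′ = concatMap (λ g → replicate (m g) g) elems

        coeff-L′ : ∀ x → coeff L′ x ≡ coeff L x / p
        coeff-L′ x = begin
          coeff L′ x
            ≡⟨ ∑-concatMap _ elems _ ⟩
          ∑ elems (λ g → ∑ (replicate (m g) g) (λ h → δ (x ∙ h)))
            ≡⟨ ∑-cong elems (λ g → ∑-replicate (m g) g _) ⟩
          ∑ elems (λ g → m g ℕ.* δ (x ∙ g))
            ≡⟨ ∑-cong elems (λ g → ≡.trans (ℕ.*-comm (m g) _) (≡.cong (ℕ._* m g) (δ-∙ x g))) ⟩
          ∑ elems (λ g → ⟦ g S.≟ x ⁻¹ ⟧ ℕ.* m g)
            ≡⟨ ∑-δ m (λ e → ≡.cong (_/ p) (conv-resp L δ-resp (⁻¹-cong e))) (x ⁻¹) ⟩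
          m (x ⁻¹)
            ≡⟨ ≡.cong (_/ p) (conv-resp L δ-resp (⁻¹-involutive x)) ⟩
          coeff L x / p ∎

      -- `L` and `p` copies of `L′` agree only in their coefficients, and of the two factors of the
      -- square only the inner one is visible through its coefficients. `conv-comm` brings the other
      -- one inside, so that it can be replaced too.
      coeff²-divide : ∀ L → (∀ x → p ∣ coeff² L x) →
                      ∃[ L′ ] ∀ x → coeff² L x ≡ p ℕ.* (p ℕ.* coeff² L′ x)
      coeff²-divide L p∣coeff²
        with L′ , coeff-L≡ ← divide L (p∣coeff²⇒p∣coeff torsionFree L p∣coeff²) =
        L′ , λ x → begin
          coeff² L x                        ≡⟨ ∑-cong L (λ g → coeff-L≡ (x ∙ g)) ⟩
          conv L (λ y → p ℕ.* coeff L′ y) x ≡⟨ conv-*ˡ L p (coeff L′) x ⟩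
          p ℕ.* conv L (coeff L′) x         ≡⟨ ≡.cong (p ℕ.*_) (conv-comm L L′ δ-resp x) ⟩
          p ℕ.* conv L′ (coeff L) x
            ≡⟨ ≡.cong (p ℕ.*_) (∑-cong L′ (λ g → coeff-L≡ (x ∙ g))) ⟩
          p ℕ.* conv L′ (λ y → p ℕ.* coeff L′ y) x
            ≡⟨ ≡.cong (p ℕ.*_) (conv-*ˡ L′ p (coeff L′) x) ⟩
          p ℕ.* (p ℕ.* coeff² L′ x)         ∎
        where open ≡-Reasoning

      -- Dividing `L` by `p` takes exactly two factors `p` out of the square. After `k` divisions a
      -- single `p` is left, and this again forces a division of the list, hence a second `p`.
      coeff²-even : ∀ k L → (∀ x → p ℕ.^ (1 ℕ.+ k ℕ.* 2) ∣ coeff² L x) →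
                    ∀ x → p ℕ.^ (2 ℕ.+ k ℕ.* 2) ∣ coeff² L x
      coeff²-even k L p^∣ x
        with L′ , coeff²-L≡ ← coeff²-divide L (λ y → ∣-trans (m∣m*n _) (p^∣ y)) =
        ≡.subst (p ℕ.^ (2 ℕ.+ k ℕ.* 2) ∣_) (≡.sym (coeff²-L≡ x))
          (*-monoʳ-∣ p (*-monoʳ-∣ p (rest k p^∣)))
        where
        rest : ∀ k → (∀ x → p ℕ.^ (1 ℕ.+ k ℕ.* 2) ∣ coeff² L x) → p ℕ.^ (k ℕ.* 2) ∣ coeff² L′ x
        rest zero    _   = 1∣ _
        rest (suc k) p^∣ = coeff²-even k L′ (λ y → *-cancelˡ-∣ p (*-cancelˡ-∣ p
          (≡.subst (p ℕ.^ (3 ℕ.+ k ℕ.* 2) ∣_) (coeff²-L≡ y) (p^∣ y)))) x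

      -- Cauchy's theorem for `B`, in contrapositive form. The sum of all elements has every
      -- coefficient 1, and its square has every coefficient `n`; if `p` divided `n`, it would
      -- divide 1.
      torsionFree⇒∤size : ¬ p ∣ n
      torsionFree⇒∤size p∣n = prime-≢1 pp (∣1⇒≡1 (≡.subst (p ∣_) (coeff≡1 ε)
        (p∣coeff²⇒p∣coeff torsionFree elems (λ x → ≡.subst (p ∣_) (≡.sym (coeff²≡n x)) p∣n) ε)))
        where
        coeff≡1 : ∀ x → coeff elems x ≡ 1
        coeff≡1 x = ≡.trans (∑-cong elems (δ-∙ x)) (∑-≟ (x ⁻¹))

        coeff²≡n : ∀ x → coeff² elems x ≡ n
        coeff²≡n x = ≡.trans (∑-cong elems λ g → coeff≡1 (x ∙ g)) ∑-1

-- Skew-Hadamard difference sets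

module SHDS (G : FiniteGroup c ℓ) (D : Subset G) (shds : IsSHDS G D) where
  open FiniteGroup G
  open import Data.Nat.Base using (_+_; _*_; _∸_)
  open GroupProperties group
  open Subset D
  open IsSHDS shds
  open IsDifferenceSet isDifferenceSet
  open Enumeration hasSize using (_≟_; elems; ∑-fibres; ∑-reindex; ∑-δ; ∑-≟)

  private
    -- In terms of `m = n − 1` the parameters are `v = 4m + 3`, `k = 2m + 1` and `λ = m`, free of
    -- truncated subtraction.
    m = ℕ.pred n
    module DE = Enumeration size
    open ≡-Reasoning

  n≡1+m : n ≡ suc m
  n≡1+m = ≡.sym (ℕ.suc-pred n)

  order≡ : order ≡ 3 + m * 4
  order≡ = ≡.trans order≡v (≡.trans (cong (λ x → 4 * x ∸ 1) n≡1+m) (lemma m))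
    where
    lemma : ∀ m → m + suc (m + suc (m + suc (m + 0))) ≡ 3 + m * 4
    lemma = solve-∀

  order%4≡3 : order ℕ.% 4 ≡ 3
  order%4≡3 = ≡.trans (cong (ℕ._% 4) order≡) ([m+kn]%n≡m%n 3 m 4)

  ds : List (Σ[ d ∈ Carrier ] d ∈ pred)
  ds = DE.elems

  1+2D : List Carrier
  1+2D = ε ∷ map proj₁ ds ++ map proj₁ ds

  Respects : (Carrier → ℕ) → Set _
  Respects φ = ∀ {x y} → x ≈ y → φ x ≡ φ y

  length-ds : ∑ ds (λ _ → 1) ≡ 1 + 2 * m
  length-ds = ≡.trans DE.∑-1 (≡.trans (cong (λ x → 2 * x ∸ 1) n≡1+m) (lemma m))
    where
    lemma : ∀ m → m + suc (m + 0) ≡ 1 + 2 * m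
    lemma = solve-∀

  ∑-ds-const : ∀ k → ∑ ds (λ _ → k) ≡ (1 + 2 * m) * k
  ∑-ds-const k = ≡.trans (∑-cong ds λ _ → ≡.sym (ℕ.*-identityˡ k))
    (≡.trans (∑-*ʳ ds (λ _ → 1) k) (cong (_* k) length-ds))

  count-∈ : ∀ {s} → s ∈ pred → ∑ ds (λ d → ⟦ s ≟ proj₁ d ⟧) ≡ 1
  count-∈ {s} s∈D = ≡.trans
    (∑-cong ds λ d → ⟦⟧-cong (s ≟ proj₁ d) (d DE.≟ (s , s∈D)) sym sym)
    (DE.∑-≟ (s , s∈D))

  count-∉ : ∀ {s} → s ∉ pred → ∑ ds (λ d → ⟦ s ≟ proj₁ d ⟧) ≡ 0
  count-∉ {s} s∉D = ≡.trans
    (∑-cong ds λ d → ⟦⟧-no (s ≟ proj₁ d) λ s≈d → s∉D (resp (sym s≈d) (proj₂ d)))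
    (∑-zero ds)

  ∑-translate : ∀ φ → Respects φ → ∀ x → ∑ elems (λ y → φ (x ∙ y)) ≡ ∑ elems φ
  ∑-translate φ φ-resp x = ∑-reindex φ φ-resp elems (x ∙_) λ z → ≡.trans
    (∑-cong elems λ y → ⟦⟧-cong (z ≟ x ∙ y) (y ≟ x ⁻¹ ∙ z)
      (λ z≈xy → sym (trans (∙-congˡ z≈xy) (\\-leftDividesʳ x y)))
      (λ y≈x⁻¹z → sym (trans (∙-congˡ y≈x⁻¹z) (\\-leftDividesˡ x z))))
    (∑-≟ (x ⁻¹ ∙ z))

  -- The identity `1 + D + D⁻¹ = G`, translated by `y` and tested against `φ`. The group ring
  -- identities about `D` are stated against arbitrary test functions; one that factors through a
  -- quotient then gives the identity in the quotient.
  partition : ∀ φ → Respects φ → ∀ y →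
              φ y + (∑ ds (λ d → φ (y ∙ proj₁ d)) + ∑ ds (λ d → φ (y ∙ proj₁ d ⁻¹))) ≡ ∑ elems φ
  partition φ φ-resp y = begin
    φ y + (∑ ds (λ d → φ (y ∙ proj₁ d)) + ∑ ds (λ d → φ (y ∙ proj₁ d ⁻¹)))
      ≡⟨ cong₂ _+_ (φ-resp (sym (identityʳ y))) (≡.sym (∑-ts (λ t → φ (y ∙ t)))) ⟩
    ∑ ts (λ t → φ (y ∙ t))
      ≡⟨ ∑-reindex φ φ-resp ts (y ∙_) (λ x → ≡.trans
           (∑-cong ts λ t → ⟦⟧-cong (x ≟ y ∙ t) (y ⁻¹ ∙ x ≟ t)
             (λ x≈yt → trans (∙-congˡ x≈yt) (\\-leftDividesʳ y t))
             (λ y⁻¹x≈t → sym (trans (∙-congˡ (sym y⁻¹x≈t)) (\\-leftDividesˡ y x))))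
           (once (y ⁻¹ ∙ x))) ⟩
    ∑ elems φ ∎
    where
    ts : List Carrier
    ts = ε ∷ map proj₁ ds ++ map (_⁻¹ ∘ proj₁) ds

    ∑-ts : ∀ f → ∑ (map proj₁ ds ++ map (_⁻¹ ∘ proj₁) ds) f ≡
                 ∑ ds (f ∘ proj₁) + ∑ ds (λ d → f (proj₁ d ⁻¹))
    ∑-ts f = ≡.trans (∑-++ (map proj₁ ds) _ f)
      (cong₂ _+_ (∑-map proj₁ ds f) (∑-map (_⁻¹ ∘ proj₁) ds f))

    ∉Inverses⇒⁻¹∉ : ∀ {s} → s ∉ Inverses G pred → s ⁻¹ ∉ pred
    ∉Inverses⇒⁻¹∉ s∉ s⁻¹∈ = s∉ (_ , s⁻¹∈ , sym (⁻¹-involutive _))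

    counts : ∀ s → ⟦ s ≟ ε ⟧ + (∑ ds (λ d → ⟦ s ≟ proj₁ d ⟧) + ∑ ds (λ d → ⟦ s ⁻¹ ≟ proj₁ d ⟧)) ≡ 1
    counts s with covers s
    ... | inj₁ s∈D = cong₂ _+_ (⟦⟧-no (s ≟ ε) λ s≈ε → ε∉D (resp s≈ε s∈D))
            (cong₂ _+_ (count-∈ s∈D) (count-∉ (∉Inverses⇒⁻¹∉ (D∩D⁻¹≡∅ s s∈D))))
    ... | inj₂ (inj₁ s∈D⁻¹@(d , d∈D , s≈d⁻¹)) = cong₂ _+_
            (⟦⟧-no (s ≟ ε) λ s≈ε → ε∉D⁻¹ (d , d∈D , trans (sym s≈ε) s≈d⁻¹))
            (cong₂ _+_ (count-∉ λ s∈D → D∩D⁻¹≡∅ s s∈D s∈D⁻¹)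
                       (count-∈ (resp (sym (trans (⁻¹-cong s≈d⁻¹) (⁻¹-involutive d))) d∈D)))
    ... | inj₂ (inj₂ s≈ε) = cong₂ _+_ (⟦⟧-yes (s ≟ ε) s≈ε)
            (cong₂ _+_ (count-∉ λ s∈D → ε∉D (resp s≈ε s∈D))
                       (count-∉ λ s⁻¹∈D → ε∉D (resp (trans (⁻¹-cong s≈ε) ε⁻¹≈ε) s⁻¹∈D)))

    once : ∀ s → ∑ ts (λ t → ⟦ s ≟ t ⟧) ≡ 1
    once s = ≡.trans (cong (⟦ s ≟ ε ⟧ +_) (≡.trans (∑-ts (λ t → ⟦ s ≟ t ⟧))
      (cong (∑ ds (λ d → ⟦ s ≟ proj₁ d ⟧) +_) (∑-cong ds λ d →
        ⟦⟧-cong (s ≟ proj₁ d ⁻¹) (s ⁻¹ ≟ proj₁ d)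
          (λ s≈d⁻¹ → trans (⁻¹-cong s≈d⁻¹) (⁻¹-involutive _))
          (λ s⁻¹≈d → trans (sym (⁻¹-involutive s)) (⁻¹-cong s⁻¹≈d))))))
      (counts s)

  #representations : Carrier → ℕ
  #representations g = ∑ ds λ d → ∑ ds λ d′ → ⟦ g ≟ proj₁ d ∙ proj₁ d′ ⁻¹ ⟧

  #representations-ε : ∀ {g} → g ≈ ε → #representations g ≡ 1 + 2 * m
  #representations-ε {g} g≈ε = ≡.trans
    (∑-cong ds λ d → ≡.trans
      (∑-cong ds λ d′ → ⟦⟧-cong (g ≟ proj₁ d ∙ proj₁ d′ ⁻¹) (proj₁ d ≟ proj₁ d′)
        (λ g≈ → x∙y⁻¹≈ε⇒x≈y _ _ (trans (sym g≈) g≈ε))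
        (λ d≈d′ → trans g≈ε (sym (x≈y⇒x∙y⁻¹≈ε d≈d′))))
      (count-∈ (proj₂ d)))
    length-ds

  -- Double counting of pairs of entries of `ds` against the enumerated representations. The latter
  -- exclude `d₁ ≈ d₂`, which loses nothing because such pairs represent only `ε`.
  #representations-≉ε : ∀ {g} → ¬ g ≈ ε → #representations g ≡ m
  #representations-≉ε {g} g≉ε = begin
    #representations g
      ≡⟨ (∑-cong ds λ d → ∑-cong ds λ d′ → indicator d d′) ⟩
    (∑ ds λ d → ∑ ds λ d′ → ∑ RE.elems λ r → left r d * right r d′)
      ≡⟨ (∑-cong ds λ d → ∑-swap ds RE.elems _) ⟩
    (∑ ds λ d → ∑ RE.elems λ r → ∑ ds λ d′ → left r d * right r d′)
      ≡⟨ ∑-swap ds RE.elems _ ⟩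
    (∑ RE.elems λ r → ∑ ds λ d → ∑ ds λ d′ → left r d * right r d′)
      ≡⟨ ∑-cong RE.elems once ⟩
    ∑ RE.elems (λ _ → 1)
      ≡⟨ RE.∑-1 ⟩
    n ∸ 1
      ≡⟨ cong (_∸ 1) n≡1+m ⟩
    m ∎
    where
    module RE = Enumeration (difference g g≉ε)
    Rep = Σ[ (d₁ , d₂) ∈ Carrier × Carrier ]
            d₁ ∈ pred × d₂ ∈ pred × ¬ (d₁ ≈ d₂) × g ≈ d₁ ∙ d₂ ⁻¹

    left right : Rep → Σ[ d ∈ Carrier ] d ∈ pred → ℕ
    left  r d = ⟦ proj₁ (proj₁ r) ≟ proj₁ d ⟧
    right r d = ⟦ proj₂ (proj₁ r) ≟ proj₁ d ⟧

    indicator : ∀ d d′ → ⟦ g ≟ proj₁ d ∙ proj₁ d′ ⁻¹ ⟧ ≡ ∑ RE.elems (λ r → left r d * right r d′)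
    indicator d d′ with g ≟ proj₁ d ∙ proj₁ d′ ⁻¹
    ... | yes g≈ = ≡.trans (≡.sym (RE.∑-≟ rep)) (∑-cong RE.elems λ r →
            ⟦⟧-× (r RE.≟ rep) (_ ≟ _) (_ ≟ _) _,_ λ e → e)
      where
      rep : Rep
      rep = (proj₁ d , proj₁ d′) , proj₂ d , proj₂ d′ ,
        (λ d≈d′ → g≉ε (trans g≈ (x≈y⇒x∙y⁻¹≈ε d≈d′))) , g≈
    ... | no  g≉ = ≡.sym (≡.trans (∑-cong RE.elems λ where
            r@(_ , _ , _ , _ , g≈) → ≡.sym (⟦⟧-× (no g≉) (_ ≟ _) (_ ≟ _)
              (λ d₁≈d d₂≈d′ → trans g≈ (∙-cong d₁≈d (⁻¹-cong d₂≈d′)))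
              (λ g≈ → contradiction g≈ g≉))) (∑-zero RE.elems))

    once : ∀ r → (∑ ds λ d → ∑ ds λ d′ → left r d * right r d′) ≡ 1
    once r@((d₁ , d₂) , d₁∈D , d₂∈D , _) = begin
      (∑ ds λ d → ∑ ds λ d′ → left r d * right r d′)
        ≡⟨ (∑-cong ds λ d → ∑-*ˡ ds (left r d) (right r)) ⟩
      (∑ ds λ d → left r d * ∑ ds (right r))
        ≡⟨ ∑-*ʳ ds (left r) _ ⟩
      ∑ ds (left r) * ∑ ds (right r)
        ≡⟨ cong₂ _*_ (count-∈ d₁∈D) (count-∈ d₂∈D) ⟩
      1 ∎

  -- The difference set equation `D D⁻¹ = (k − λ) + λ G`, with the term `− λ` moved to the left.
  D∙D⁻¹ : ∀ φ → Respects φ → ∀ x →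
          (∑ ds λ d → ∑ ds λ d′ → φ (x ∙ proj₁ d ∙ proj₁ d′ ⁻¹)) + m * φ x ≡
          (1 + 2 * m) * φ x + m * ∑ elems φ
  D∙D⁻¹ φ φ-resp x = begin
    (∑ ds λ d → ∑ ds λ d′ → φ (x ∙ proj₁ d ∙ proj₁ d′ ⁻¹)) + m * φ x
      ≡⟨ cong₂ _+_ fibres (cong (m *_) φx) ⟩
    ∑ elems (λ g → #representations g * ψ g) + m * ∑ elems (λ g → ⟦ g ≟ ε ⟧ * ψ g)
      ≡⟨ cong (∑ elems (λ g → #representations g * ψ g) +_) (∑-*ˡ elems m _) ⟨
    ∑ elems (λ g → #representations g * ψ g) + ∑ elems (λ g → m * (⟦ g ≟ ε ⟧ * ψ g))
      ≡⟨ ∑-+ elems _ _ ⟨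
    ∑ elems (λ g → #representations g * ψ g + m * (⟦ g ≟ ε ⟧ * ψ g))
      ≡⟨ ∑-cong elems pointwise ⟩
    ∑ elems (λ g → (1 + 2 * m) * (⟦ g ≟ ε ⟧ * ψ g) + m * ψ g)
      ≡⟨ ∑-+ elems _ _ ⟩
    ∑ elems (λ g → (1 + 2 * m) * (⟦ g ≟ ε ⟧ * ψ g)) + ∑ elems (λ g → m * ψ g)
      ≡⟨ cong₂ _+_ (∑-*ˡ elems (1 + 2 * m) _) (∑-*ˡ elems m ψ) ⟩
    (1 + 2 * m) * ∑ elems (λ g → ⟦ g ≟ ε ⟧ * ψ g) + m * ∑ elems ψ
      ≡⟨ cong₂ (λ s t → (1 + 2 * m) * s + m * t) (≡.sym φx) (∑-translate φ φ-resp x) ⟩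
    (1 + 2 * m) * φ x + m * ∑ elems φ ∎
    where
    ψ : Carrier → ℕ
    ψ y = φ (x ∙ y)

    ψ-resp : Respects ψ
    ψ-resp y≈z = φ-resp (∙-congˡ y≈z)

    φx : φ x ≡ ∑ elems (λ g → ⟦ g ≟ ε ⟧ * ψ g)
    φx = ≡.trans (φ-resp (sym (identityʳ x))) (≡.sym (∑-δ ψ ψ-resp ε))

    fibres : (∑ ds λ d → ∑ ds λ d′ → φ (x ∙ proj₁ d ∙ proj₁ d′ ⁻¹)) ≡
             ∑ elems (λ g → #representations g * ψ g)
    fibres = begin
      (∑ ds λ d → ∑ ds λ d′ → φ (x ∙ proj₁ d ∙ proj₁ d′ ⁻¹))
        ≡⟨ (∑-cong ds λ d → ∑-cong ds λ d′ → φ-resp (assoc x (proj₁ d) (proj₁ d′ ⁻¹))) ⟩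
      (∑ ds λ d → ∑ ds λ d′ → ψ (proj₁ d ∙ proj₁ d′ ⁻¹))
        ≡⟨ (∑-cong ds λ d → ∑-fibres ψ ψ-resp ds (λ d′ → proj₁ d ∙ proj₁ d′ ⁻¹)) ⟩
      (∑ ds λ d → ∑ elems λ g → (∑ ds λ d′ → ⟦ g ≟ proj₁ d ∙ proj₁ d′ ⁻¹ ⟧) * ψ g)
        ≡⟨ ∑-swap ds elems _ ⟩
      (∑ elems λ g → ∑ ds λ d → (∑ ds λ d′ → ⟦ g ≟ proj₁ d ∙ proj₁ d′ ⁻¹ ⟧) * ψ g)
        ≡⟨ (∑-cong elems λ g → ∑-*ʳ ds _ (ψ g)) ⟩
      ∑ elems (λ g → #representations g * ψ g) ∎

    pointwise : ∀ g → #representations g * ψ g + m * (⟦ g ≟ ε ⟧ * ψ g) ≡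
                      (1 + 2 * m) * (⟦ g ≟ ε ⟧ * ψ g) + m * ψ g
    pointwise g with g ≟ ε
    ... | yes g≈ε rewrite #representations-ε g≈ε = lemma m (ψ g)
      where
      lemma : ∀ m s → (1 + 2 * m) * s + m * (1 * s) ≡ (1 + 2 * m) * (1 * s) + m * s
      lemma = solve-∀
    ... | no  g≉ε rewrite #representations-≉ε g≉ε = lemma m (ψ g)
      where
      lemma : ∀ m s → m * s + m * 0 ≡ (1 + 2 * m) * 0 + m * s
      lemma = solve-∀

  -- Multiplying `1 + D + D⁻¹ = G` by `D` gives `D + D² + D D⁻¹ = k G`. Subtracting the equation for
  -- `D D⁻¹` leaves `D + D² = (k − λ)(G − 1)`, where `k − λ = m + 1`.
  D∙D : ∀ φ → Respects φ → ∀ x →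
        (∑ ds λ d → φ (x ∙ proj₁ d)) +
        (∑ ds λ d → ∑ ds λ d′ → φ (x ∙ proj₁ d ∙ proj₁ d′)) + suc m * φ x ≡
        suc m * ∑ elems φ
  D∙D φ φ-resp x = cancel m X X² XX⁻¹ (φ x) (∑ elems φ) total (D∙D⁻¹ φ φ-resp x)
    where
    X    = ∑ ds λ d → φ (x ∙ proj₁ d)
    X²   = ∑ ds λ d → ∑ ds λ d′ → φ (x ∙ proj₁ d ∙ proj₁ d′)
    XX⁻¹ = ∑ ds λ d → ∑ ds λ d′ → φ (x ∙ proj₁ d ∙ proj₁ d′ ⁻¹)

    total : X + (X² + XX⁻¹) ≡ (1 + 2 * m) * ∑ elems φ
    total = begin
      X + (X² + XX⁻¹)                       ≡⟨ cong (X +_) (∑-+ ds _ _) ⟨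
      X + ∑ ds (λ d → Y d + Y′ d)           ≡⟨ ∑-+ ds _ _ ⟨
      ∑ ds (λ d → φ (x ∙ proj₁ d) + (Y d + Y′ d))
        ≡⟨ (∑-cong ds λ d → partition φ φ-resp (x ∙ proj₁ d)) ⟩
      ∑ ds (λ _ → ∑ elems φ)                ≡⟨ ∑-ds-const _ ⟩
      (1 + 2 * m) * ∑ elems φ               ∎
      where
      Y  = λ d → ∑ ds λ d′ → φ (x ∙ proj₁ d ∙ proj₁ d′)
      Y′ = λ d → ∑ ds λ d′ → φ (x ∙ proj₁ d ∙ proj₁ d′ ⁻¹)

    cancel : ∀ m a b c f j → a + (b + c) ≡ (1 + 2 * m) * j →
             c + m * f ≡ (1 + 2 * m) * f + m * j →
             a + b + suc m * f ≡ suc m * j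
    -- The subtraction of `c≡` from `abc≡`: the summand `m * j + m * f` completes both sides so that
    -- the two equations can be substituted.
    cancel m a b c f j abc≡ c≡ = ℕ.+-cancelʳ-≡ (m * j + m * f) _ _ (begin
      a + b + suc m * f + (m * j + m * f)    ≡⟨ lemma₁ m a b f j ⟩
      a + b + ((1 + 2 * m) * f + m * j)      ≡⟨ cong (a + b +_) c≡ ⟨
      a + b + (c + m * f)                    ≡⟨ lemma₂ m a b c f ⟩
      a + (b + c) + m * f                    ≡⟨ cong (_+ m * f) abc≡ ⟩
      (1 + 2 * m) * j + m * f                ≡⟨ lemma₃ m f j ⟩
      suc m * j + (m * j + m * f)            ∎)
      where
      lemma₁ : ∀ m a b f j → a + b + suc m * f + (m * j + m * f) ≡ a + b + ((1 + 2 * m) * f + m * j)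
      lemma₁ = solve-∀
      lemma₂ : ∀ m a b c f → a + b + (c + m * f) ≡ a + (b + c) + m * f
      lemma₂ = solve-∀
      lemma₃ : ∀ m f j → (1 + 2 * m) * j + m * f ≡ suc m * j + (m * j + m * f)
      lemma₃ = solve-∀

  -- In the group ring, (2 D + 1)² = (v + 1) G − v.
  square : ∀ φ → Respects φ → ∀ x →
           (∑ 1+2D λ g → ∑ 1+2D λ h → φ (x ∙ g ∙ h)) + order * φ x ≡ suc order * ∑ elems φ
  square φ φ-resp x = begin
    (∑ 1+2D λ g → F (x ∙ g)) + order * φ x
      ≡⟨ cong₂ (λ s v → s + v * φ x) (F≡ F F-resp x) order≡ ⟩
    F x + 2 * (∑ ds λ d → F (x ∙ proj₁ d)) + (3 + m * 4) * φ x
      ≡⟨ cong₂ (λ s t → s + 2 * t + (3 + m * 4) * φ x) (F≡ φ φ-resp x)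
           (≡.trans (∑-cong ds λ d → F≡ φ φ-resp (x ∙ proj₁ d))
             (≡.trans (∑-+ ds _ _) (cong (X +_) (∑-*ˡ ds 2 _)))) ⟩
    φ x + 2 * X + 2 * (X + 2 * X²) + (3 + m * 4) * φ x
      -- The term `φ x` occurs `1 + v = 4 (m + 1)` times, just as `D∙D` requires after the factor 4
      -- is taken out.
      ≡⟨ lemma₁ m (φ x) X X² ⟩
    4 * (X + X² + suc m * φ x)
      ≡⟨ cong (4 *_) (D∙D φ φ-resp x) ⟩
    4 * (suc m * ∑ elems φ)
      ≡⟨ lemma₂ m (∑ elems φ) ⟩
    suc (3 + m * 4) * ∑ elems φ
      ≡⟨ cong (λ v → suc v * ∑ elems φ) order≡ ⟨
    suc order * ∑ elems φ ∎
    where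
    F : Carrier → ℕ
    F y = ∑ 1+2D λ h → φ (y ∙ h)

    F-resp : Respects F
    F-resp y≈z = ∑-cong 1+2D λ h → φ-resp (∙-congʳ y≈z)

    X  = ∑ ds λ d → φ (x ∙ proj₁ d)
    X² = ∑ ds λ d → ∑ ds λ d′ → φ (x ∙ proj₁ d ∙ proj₁ d′)

    F≡ : ∀ ψ → Respects ψ → ∀ y → (∑ 1+2D λ h → ψ (y ∙ h)) ≡ ψ y + 2 * (∑ ds λ d → ψ (y ∙ proj₁ d))
    F≡ ψ ψ-resp y = cong₂ _+_ (ψ-resp (identityʳ y))
      (≡.trans (∑-++ (map proj₁ ds) (map proj₁ ds) _)
        (cong₂ _+_ (∑-map proj₁ ds _) (≡.trans (∑-map proj₁ ds _) (≡.sym (ℕ.+-identityʳ _)))))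

    lemma₁ : ∀ m f a b → f + 2 * a + 2 * (a + 2 * b) + (3 + m * 4) * f ≡ 4 * (a + b + suc m * f)
    lemma₁ = solve-∀
    lemma₂ : ∀ m j → 4 * (suc m * j) ≡ suc (3 + m * 4) * j
    lemma₂ = solve-∀

-- The image of the difference set in a finite abelian quotient

module AbelianQuotient
  (G : FiniteGroup c ℓ) (D : Subset G) (shds : IsSHDS G D)
  (B : AbelianGroup b ℓ′) {n} (hasSize : AbelianGroup.setoid B HasSize n)
  (f : FiniteGroup.Carrier G → AbelianGroup.Carrier B)
  (f-isHomomorphism : IsGroupHomomorphism (FiniteGroup.rawGroup G) (AbelianGroup.rawGroup B) f)
  (f-surjective : ∀ y → ∃[ x ] AbelianGroup._≈_ B (f x) y)
  where
  open import Data.Nat.Base using (_+_; _*_; _^_)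
  open AbelianGroup B
  open IsGroupHomomorphism f-isHomomorphism using ()
    renaming (⟦⟧-cong to f-cong; homo to f-homo)
  open GroupProperties group
  open SHDS G D shds using (1+2D; square; ∑-translate)
  private
    module G  = FiniteGroup G
    module GE = Enumeration G.hasSize
    module BE = Enumeration hasSize
    open BE using (_≟_)
  open GroupRing B _≟_

  image : List Carrier
  image = map f 1+2D

  kernelSize : ℕ
  kernelSize = ∑ GE.elems (δ ∘ f)

  -- This is `square` tested against `δ ∘ f`, whose sum over `G` is the size of the kernel.
  coeff²-image : ∀ x → coeff² image (f x) + G.order * δ (f x) ≡ suc G.order * kernelSize
  coeff²-image x = ≡.trans (cong (_+ G.order * δ (f x)) (begin
    coeff² image (f x)
      ≡⟨ ∑-map f 1+2D _ ⟩
    (∑ 1+2D λ g → coeff image (f x ∙ f g))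
      ≡⟨ (∑-cong 1+2D λ g → ∑-map f 1+2D _) ⟩
    (∑ 1+2D λ g → ∑ 1+2D λ h → δ (f x ∙ f g ∙ f h))
      ≡⟨ (∑-cong 1+2D λ g → ∑-cong 1+2D λ h →
            δ-resp (sym (trans (f-homo _ h) (∙-congʳ (f-homo x g))))) ⟩
    (∑ 1+2D λ g → ∑ 1+2D λ h → δ (f (x G.∙ g G.∙ h))) ∎))
    (square (δ ∘ f) (δ-resp ∘ f-cong) x)
    where open ≡-Reasoning

  order≡ : G.order ≡ n * kernelSize
  order≡ = begin
    G.order                                           ≡⟨ GE.∑-1 ⟨
    ∑ GE.elems (λ _ → 1)                              ≡⟨ ∑-cong GE.elems (λ g → BE.∑-≟ (f g)) ⟨
    (∑ GE.elems λ g → ∑ BE.elems λ y → ⟦ y ≟ f g ⟧)   ≡⟨ ∑-swap GE.elems BE.elems _ ⟩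
    (∑ BE.elems λ y → ∑ GE.elems λ g → ⟦ y ≟ f g ⟧)   ≡⟨ ∑-cong BE.elems fibre ⟩
    ∑ BE.elems (λ _ → kernelSize)                     ≡⟨ BE.∑-const kernelSize ⟩
    n * kernelSize                                    ∎
    where
    open ≡-Reasoning
    fibre : ∀ y → (∑ GE.elems λ g → ⟦ y ≟ f g ⟧) ≡ kernelSize
    -- Left translation by a preimage of `y ⁻¹` carries the fibre over `y` to the kernel.
    fibre y with x , fx≈y⁻¹ ← f-surjective (y ⁻¹) = ≡.trans
      (∑-cong GE.elems λ g → ⟦⟧-cong (y ≟ f g) (f (x G.∙ g) ≟ ε)
        (λ y≈fg → trans (f-homo x g) (trans (∙-cong fx≈y⁻¹ (sym y≈fg)) (inverseˡ y)))
        (λ fxg≈ε → sym (trans (inverseʳ-unique (y ⁻¹) (f g)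
          (trans (∙-congʳ (sym fx≈y⁻¹)) (trans (sym (f-homo x g)) fxg≈ε))) (⁻¹-involutive y))))
      (∑-translate (δ ∘ f) (δ-resp ∘ f-cong) x)

  -- Let `p ^ e` be the exact power of `p` in `v`. As `p` does not divide |B|, `p ^ e` divides
  -- `kernelSize`, hence all coefficients of the square, the one at the identity included. As `e` is
  -- odd, so does `p ^ suc e`. Away from the identity the coefficient is `(v + 1) * kernelSize` with
  -- `v + 1` prime to `p`, so `p ^ suc e` divides `kernelSize` and therefore `v`, a contradiction.
  trivial : ∀ {p} → Prime p → TorsionFree p →
            multiplicity p G.order {{G.order-nonZero}} % 2 ≡ 1 → ∀ y → y ≈ ε
  trivial {p} pp torsionFree odd y
    with w , order≡p^e*w , p∤w ← multiplicity-spec pp G.order {{G.order-nonZero}}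
    with x , fx≈y ← f-surjective y = decidable-stable (y ≟ ε) λ y≉ε →
      let coeff²≡ : coeff² image y ≡ suc G.order * kernelSize
          coeff²≡ = ≡.trans (coeff²-resp (sym fx≈y)) (≡.trans (≡.sym (≡.trans
            (cong (λ d → coeff² image (f x) + G.order * d)
              (⟦⟧-no (f x ≟ ε) (y≉ε ∘ trans (sym fx≈y))))
            (≡.trans (cong (coeff² image (f x) +_) (ℕ.*-zeroʳ G.order)) (ℕ.+-identityʳ _))))
            (coeff²-image x))
          p^1+e∣kernelSize : p ^ suc e ∣ kernelSize
          p^1+e∣kernelSize = p^e∣m*n⇒p^e∣m pp p∤1+order (suc e)
            (≡.subst (p ^ suc e ∣_) (≡.trans coeff²≡ (ℕ.*-comm (suc G.order) kernelSize))
              (p^1+e∣coeff² y))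
      in p∤w (*-cancelˡ-∣ (p ^ e) {{ℕ.m^n≢0 p e}} (≡.subst₂ _∣_ (ℕ.*-comm p (p ^ e))
           (≡.trans (≡.sym order≡) order≡p^e*w) (∣n⇒∣m*n n p^1+e∣kernelSize)))
    where
    instance _ = prime⇒nonZero pp

    e k : ℕ
    e = multiplicity p G.order {{G.order-nonZero}}
    k = e / 2

    e≡ : e ≡ 1 + k * 2
    e≡ = ≡.trans (m≡m%n+[m/n]*n e 2) (cong (_+ k * 2) odd)

    coeff²-resp : ∀ {y z} → y ≈ z → coeff² image y ≡ coeff² image z
    coeff²-resp = conv-resp image (conv-resp image δ-resp)

    p^e∣order : p ^ e ∣ G.order
    p^e∣order = ≡.subst (p ^ e ∣_) (≡.sym order≡p^e*w) (m∣m*n w)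

    -- Being odd, `e` is positive, so `p` divides the order and cannot divide its successor.
    p∤1+order : ¬ p ∣ suc G.order
    p∤1+order p∣ = prime-≢1 pp (∣1⇒≡1 (∣m+n∣m⇒∣n (≡.subst (p ∣_) (ℕ.+-comm 1 G.order) p∣)
      (∣-trans (≡.subst (λ e → p ∣ p ^ e) (≡.sym e≡) (m∣m*n _)) p^e∣order)))

    p^e∣kernelSize : p ^ e ∣ kernelSize
    p^e∣kernelSize = p^e∣m*n⇒p^e∣m pp (torsionFree⇒∤size pp hasSize torsionFree) e
      (≡.subst (p ^ e ∣_) (≡.trans order≡ (ℕ.*-comm n kernelSize)) p^e∣order)

    p^e∣coeff² : ∀ y → p ^ e ∣ coeff² image y
    p^e∣coeff² y with x , fx≈y ← f-surjective y = ≡.subst (p ^ e ∣_) (coeff²-resp fx≈y)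
      (∣m+n∣m⇒∣n (≡.subst (p ^ e ∣_)
        (≡.trans (≡.sym (coeff²-image x)) (ℕ.+-comm (coeff² image (f x)) _))
        (∣n⇒∣m*n (suc G.order) p^e∣kernelSize)) (∣m⇒∣m*n (δ (f x)) p^e∣order))

    p^1+e∣coeff² : ∀ y → p ^ suc e ∣ coeff² image y
    p^1+e∣coeff² = ≡.subst (λ e → (∀ y → p ^ e ∣ coeff² image y) → ∀ y → p ^ suc e ∣ coeff² image y)
      (≡.sym e≡) (coeff²-even pp hasSize torsionFree k image) p^e∣coeff²

-- The abelianisation and its primary parts

module _ (G : FiniteGroup c ℓ) where
  open FiniteGroup G using (group; order; order-nonZero)

  abelianisation-abelianGroup : AbelianGroup c (c ⊔ ℓ)
  abelianisation-abelianGroup = record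
    { isAbelianGroup = record
      { isGroup = Group.isGroup (abelianisation group)
      -- The coset relation asks for `(x ∙ y) ⁻¹ ∙ (y ∙ x)` in G′, which is the commutator of `y`
      -- and `x`.
      ; comm = λ x y → eq (∙-congʳ (sym (⁻¹-anti-homo-∙ x y))) (gen (y , x , refl))
      }
    }
    where
    open FiniteGroup G hiding (group)
    open GroupProperties group

  open import Data.Nat.Base using (_*_; _^_)

  private
    A = abelianisation-abelianGroup
    module A = AbelianGroup A
  open Mult A.monoid using ()
    renaming (_×_ to _·_; ×-congʳ to ·-congʳ; ×-assocˡ to ·-assocˡ)

  -- Triviality of `B` says that `P`, the full power of `p` in the index, annihilates G/G′. Since
  -- `q` is coprime to `P`, nothing but the identity is killed by `q`, and Cauchy's theorem in the
  -- form `torsionFree⇒∤size` excludes `q` from the index.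
  ¬admitsSHDS : ∀ {p} → Prime p → multiplicity p order {{order-nonZero}} % 2 ≡ 1 →
                ∀ {q m} → Index group (commutator-isSubgroup group) m →
                Prime q → q ∣ m → q ≢ p →
                ¬ AdmitsSHDS G
  ¬admitsSHDS {p} pp odd {q} {m} A-hasSize pq q∣m q≢p (D , shds) =
    torsionFree⇒∤size pq A-hasSize A-torsionFree q∣m
    where
    instance m-nonZero = Fin.nonZeroIndex (Inverse.to A-hasSize A.ε)
    module AE = Enumeration A-hasSize
    open GroupRing A AE._≟_ using (torsionFree⇒∤size)

    P : ℕ
    P = p ^ multiplicity p m

    B : AbelianGroup c (c ⊔ ℓ)
    B = quotientByTorsion A P
    module B = AbelianGroup B
    open Mult B.monoid using () renaming (_×_ to _·B_)

    B-hasSize : ∃[ n ] B.setoid HasSize n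
    B-hasSize = quotient-hasSize A-hasSize B.isEquivalence (λ {x} {y} → ·-congʳ P {x} {y})
                  (λ x y → P · x AE.≟ P · y)

    ·B≡· : ∀ n x → n ·B x ≡ n · x
    ·B≡· zero    x = ≡.refl
    ·B≡· (suc n) x = cong (x A.∙_) (·B≡· n x)

    P·ε≈ε : P · A.ε A.≈ A.ε
    P·ε≈ε = ·-ε A P

    -- If `p` kills `x` in `B`, then `P · x` is killed in G/G′ by `p` and, because `m` is `P * w`,
    -- also by `w`, which is prime to `p`.
    B-torsionFree : ∀ x → p ·B x B.≈ B.ε → x B.≈ B.ε
    B-torsionFree x px≈ε with w , m≡P*w , p∤w ← multiplicity-spec pp m = begin
      P · x    ≈⟨ coprime-annihilators A (prime-coprime pp p∤w)
                    (begin
                      p · (P · x)     ≈⟨ ·-assocˡ x p P ⟩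
                      (p * P) · x     ≡⟨ cong (_· x) (ℕ.*-comm p P) ⟩
                      (P * p) · x     ≈⟨ ·-assocˡ x P p ⟨
                      P · (p · x)     ≡⟨ cong (P ·_) (·B≡· p x) ⟨
                      P · (p ·B x)    ≈⟨ px≈ε ⟩
                      P · A.ε         ≈⟨ P·ε≈ε ⟩
                      A.ε             ∎)
                    (begin
                      w · (P · x)     ≈⟨ ·-assocˡ x w P ⟩
                      (w * P) · x     ≡⟨ cong (_· x) (≡.trans (ℕ.*-comm w P) (≡.sym m≡P*w)) ⟩
                      m · x           ≈⟨ order-annihilates A A-hasSize x ⟩
                      A.ε             ∎) ⟩
      A.ε      ≈⟨ P·ε≈ε ⟨
      P · A.ε  ∎
      where open SetoidReasoning A.setoid

    B-trivial : ∀ x → x B.≈ B.ε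
    B-trivial = AbelianQuotient.trivial G D shds B (proj₂ B-hasSize) (λ x → x)
      id-isHomomorphism (λ y → y , B.refl {y}) pp B-torsionFree odd
      where
      module G = FiniteGroup G
      id-isHomomorphism : IsGroupHomomorphism G.rawGroup B.rawGroup (λ x → x)
      id-isHomomorphism = record
        { isMonoidHomomorphism = record
          { isMagmaHomomorphism = record
            { isRelHomomorphism = record
              { cong = λ {x} {y} x≈y → ·-congʳ P {x} {y}
                  (eq (G.trans (G.sym (G.inverseˡ x)) (G.∙-congˡ x≈y)) unit)
              }
            ; homo = λ x y → B.refl {x B.∙ y}
            }
          ; ε-homo = B.refl {B.ε}
          }
        ; ⁻¹-homo = λ x → B.refl {x B.⁻¹}
        }

    A-torsionFree : ∀ x → q · x A.≈ A.ε → x A.≈ A.ε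
    A-torsionFree x qx≈ε = coprime-annihilators A {q} {P} {x}
      (prime-coprime pq λ q∣P → q≢p (prime∣prime⇒≡ pq pp (prime∣^⇒∣ p (multiplicity p m) pq q∣P)))
      qx≈ε (A.trans {P · x} {P · A.ε} {A.ε} (B-trivial x) P·ε≈ε)

  -- The residue `v % 4 ≡ 3` yields a prime of odd multiplicity. By `¬admitsSHDS` the index of G′
  -- then has no other prime factor, so it is a power of that prime, possibly the zeroth.
  admitsSHDS⇒pGroup : AdmitsSHDS G → ∃[ p ] (Prime p × p % 4 ≡ 3 ×
                        IsPGroup p (abelianisation group) ×
                        multiplicity p order {{order-nonZero}} % 2 ≡ 1)
  admitsSHDS⇒pGroup admits@(D , shds) =
    let p , pp , p%4≡3 , odd = ∃-odd-multiplicity order {{order-nonZero}} (SHDS.order%4≡3 G D shds)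
        m , hasSize = abelianisation-hasSize G
        k , m≡p^k = primePower pp m {{Fin.nonZeroIndex (Inverse.to hasSize A.ε)}} λ {q} pq q∣m →
          decidable-stable (q ℕ.≟ p) λ q≢p → ¬admitsSHDS pp odd hasSize pq q∣m q≢p admits
    in p , pp , p%4≡3 , (k , ≡.subst (A.setoid HasSize_) m≡p^k hasSize) , odd

corollary2p3 : ∀ {c ℓ} (G : FiniteGroup c ℓ) →
    ((π₁ : ℕ) → Prime π₁ → π₁ ∣ ∣ G ∣ → multiplicity π₁ ∣ G ∣ {{FiniteGroup.order-nonZero G}} % 2 ≡ 1 →
    (π₂ m : ℕ) → Index (FiniteGroup.group G) (commutator-isSubgroup (FiniteGroup.group G)) m →
    Prime π₂ → π₂ ∣ m → π₂ ≢ π₁ →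
    ¬ AdmitsSHDS G)
    ×
    (AdmitsSHDS G →
    ∃[ p ] (Prime p × p % 4 ≡ 3 ×
    IsPGroup p (abelianisation (FiniteGroup.group G)) ×
    multiplicity p ∣ G ∣ {{FiniteGroup.order-nonZero G}} % 2 ≡ 1))
corollary2p3 G =
  (λ π₁ π₁-prime _ odd π₂ m index → ¬admitsSHDS G π₁-prime odd index) , admitsSHDS⇒pGroup G
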